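{- For each term $M\in\Lambda_I$ (the $\lambda I$-calculus), the function $\varepsilon\mapsto\mathsf{ExpLen}_M(\varepsilon)\in\mathbb{R}\cup\{+\infty\}$ on $[0,1]$ has its maximum at $\varepsilon=1$; that is, $\mathsf{ExpLen}_M(\varepsilon)\le\mathsf{ExpLen}_M(1)$ for all $\varepsilon\in[0,1]$.
   Context: $\lambda$-terms: $\Lambda$ is the set of untyped $\lambda$-terms $M,N ::= x \mid MN \mid \lambda x.M$ ($x$ in a countably infinite set of variables), modulo $\alpha$-equivalence. A $\beta$-redex is a term $(\lambda x.M)N$; its contractum is $M\{N/x\}$ (capture-avoiding substitution). $M\to_\beta N$ means that $N$ is obtained from $M$ by replacing one occurrence of a redex in $M$ (anywhere in the term) by its contractum. A term is in normal form if it has no $\beta$-reduct, reducible otherwise. $\Lambda_I$ (the $\lambda I$-calculus) is the set of terms such that for every subterm $\lambda x.N$, the variable $x$ occurs free at least once in $N$; it is closed under $\beta$-reduction. The leftmost-outermost ($\mathsf{LO}$) redex of a reducible term is the leftmost among its redexes, and the rightmost-innermost ($\mathsf{RI}$) redex is the rightmost among its redexes, the position of a redex being measured by its beginning symbol in the written term. $\mathsf{LO}(M)$, $\mathsf{RI}(M)$ denote the terms obtained from $M$ by firing these redexes. For $\varepsilon\in[0,1]$, the randomised strategy $\mathsf{P}_\varepsilon$ assigns to each reducible term $M$ the distribution $\mathsf{P}_\varepsilon(M)=\varepsilon\,\delta_{\mathsf{LO}(M)}+(1-\varepsilon)\,\delta_{\mathsf{RI}(M)}$; it is undefined on normal forms.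 Put $\mathbb{P}(M\to N)=\mathsf{P}_\varepsilon(M)(N)$ if $M$ is reducible, $0$ if $M$ is a normal form. The computation starting from $M$ is the sequence $(\rho_i)_{i\in\mathbb{N}}$ with $\rho_0$ the Dirac distribution at $M$ and $\rho_{i+1}(N)=\sum_{L}\rho_i(L)\,\mathbb{P}(L\to N)$. Write $|\rho|=\sum_N\rho(N)$ and $\mathsf{ExpLen}_M(\varepsilon)=\sum_{i=1}^\infty|\rho_i|\in\mathbb{R}\cup\{+\infty\}$. -}

module Defs where

open import Data.Empty using (⊥-elim)
open import Data.List using (List; []; _∷_; _++_; map; foldr; concatMap; deduplicate; upTo)
open import Data.List.Extrema.Nat using (argmin; argmax)
open import Data.List.Membership.Propositional using (_∈_; _∉_)
open import Data.List.Membership.Propositional.Properties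
  using (∈-map⁺; ∈-++⁺ˡ; ∈-++⁺ʳ; ∈-concatMap⁺; ∈-deduplicate⁺)
open import Data.List.Relation.Unary.All using ([])
open import Data.List.Relation.Unary.Any as Any using (here; there)
open import Data.List.Relation.Unary.AllPairs using ([]; _∷_)
open import Data.List.Relation.Unary.Unique.Propositional using (Unique)
open import Data.Nat as ℕ using (ℕ; zero; suc)
import Data.Nat.Properties as ℕ
open import Data.Product using (∃; _×_; _,_)
open import Data.Rational as ℚ using (ℚ; 0ℚ; 1ℚ; ½; ∣_∣; NonZero; Positive)
import Data.Rational.Properties as ℚ
open import Data.Rational.Solver using (module +-*-Solver)
open import Data.Sum using (inj₁; inj₂)
open import Function using (_∘_)
open import Relation.Binary.Definitions using (DecidableEquality)
open import Relation.Binary.PropositionalEquality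
  using (_≡_; refl; sym; trans; cong; subst)
open import Relation.Nullary using (Dec; yes; no)
open import Data.List.Relation.Unary.Unique.DecPropositional.Properties
  using (deduplicate-!)

-- A real number is a Cauchy sequence of rationals with a modulus; the
-- equality of real numbers is the setoid equality _≃ℝ_, not _≡_.

Eventually : (ℕ → Set) → Set
Eventually P = ∃ λ N → ∀ n → N ℕ.≤ n → P n

Cauchy : (ℕ → ℚ) → Set
Cauchy x = ∀ δ → 0ℚ ℚ.< δ →
  ∃ λ N → ∀ m n → N ℕ.≤ m → N ℕ.≤ n → ∣ x m ℚ.- x n ∣ ℚ.< δ

record ℝ : Set where
  constructor mkℝ
  field
    seq    : ℕ → ℚ
    cauchy : Cauchy seq

open ℝ public

infix  4 _≃ℝ_ _≤ℝ_ _<ℝ_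
infixl 6 _+ℝ_
infixl 7 _*ℝ_
infix  8 -ℝ_

_≃ℝ_ _≤ℝ_ _<ℝ_ : ℝ → ℝ → Set
x ≃ℝ y = ∀ δ → 0ℚ ℚ.< δ → Eventually λ n → ∣ seq x n ℚ.- seq y n ∣ ℚ.< δ
x ≤ℝ y = ∀ δ → 0ℚ ℚ.< δ → Eventually λ n → seq x n ℚ.≤ seq y n ℚ.+ δ
x <ℝ y = ∃ λ δ → 0ℚ ℚ.< δ × Eventually λ n → seq x n ℚ.+ δ ℚ.≤ seq y n

private
  half-pos : ∀ {δ} → 0ℚ ℚ.< δ → 0ℚ ℚ.< ½ ℚ.* δ
  half-pos {δ} δ>0 = ℚ.*-monoʳ-<-pos ½ δ>0

  half+half : ∀ δ → ½ ℚ.* δ ℚ.+ ½ ℚ.* δ ≡ δ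
  half+half δ = trans (sym (ℚ.*-distribʳ-+ δ ½ ½)) (ℚ.*-identityˡ δ)

  0≤∣_∣ : ∀ p → 0ℚ ℚ.≤ ∣ p ∣
  0≤∣ p ∣ = ℚ.nonNegative⁻¹ ∣ p ∣ {{ℚ.∣-∣-nonNeg p}}

  ∣+∣< : ∀ {δ} p q → ∣ p ∣ ℚ.< ½ ℚ.* δ → ∣ q ∣ ℚ.< ½ ℚ.* δ → ∣ p ℚ.+ q ∣ ℚ.< δ
  ∣+∣< {δ} p q p< q< =
    ℚ.≤-<-trans (ℚ.∣p+q∣≤∣p∣+∣q∣ p q)
      (subst (∣ p ∣ ℚ.+ ∣ q ∣ ℚ.<_) (half+half δ) (ℚ.+-mono-< p< q<))

  ∣*∣< : ∀ {B δ} → 0ℚ ℚ.< B → 0ℚ ℚ.< δ →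
    ∃ λ η → 0ℚ ℚ.< η ×
      (∀ p q → ∣ p ∣ ℚ.≤ B → ∣ q ∣ ℚ.< η → ∣ p ℚ.* q ∣ ℚ.< δ)
  ∣*∣< {B} {δ} B>0 δ>0 = η , η>0 , bound
    where
    instance
      B-pos : Positive B
      B-pos = ℚ.positive B>0
      B-nonZero : NonZero B
      B-nonZero = ℚ.pos⇒nonZero B
      δ-pos : Positive δ
      δ-pos = ℚ.positive δ>0
    η : ℚ
    η = ℚ.1/ B ℚ.* δ
    η>0 : 0ℚ ℚ.< η
    η>0 = ℚ.positive⁻¹ η
      {{ℚ.pos*pos⇒pos (ℚ.1/ B) {{ℚ.1/pos⇒pos B}} δ}}
    Bη≡δ : B ℚ.* η ≡ δ
    Bη≡δ = trans (sym (ℚ.*-assoc B (ℚ.1/ B) δ))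
      (trans (cong (ℚ._* δ) (ℚ.*-inverseʳ B)) (ℚ.*-identityˡ δ))
    bound : ∀ p q → ∣ p ∣ ℚ.≤ B → ∣ q ∣ ℚ.< η → ∣ p ℚ.* q ∣ ℚ.< δ
    bound p q p≤B q<η =
      subst (ℚ._< δ) (sym (ℚ.∣p*q∣≡∣p∣*∣q∣ p q))
        (ℚ.≤-<-trans
          (ℚ.*-monoʳ-≤-nonNeg ∣ q ∣ {{ℚ.∣-∣-nonNeg q}} p≤B)
          (subst (B ℚ.* ∣ q ∣ ℚ.<_) Bη≡δ (ℚ.*-monoʳ-<-pos B q<η)))

  ⊔-bounds : ∀ a b c d {k} → (a ℕ.⊔ b) ℕ.⊔ (c ℕ.⊔ d) ℕ.≤ k →
    a ℕ.≤ k × b ℕ.≤ k × c ℕ.≤ k × d ℕ.≤ k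
  ⊔-bounds a b c d ≤k =
    let ab = ℕ.m⊔n≤o⇒m≤o (a ℕ.⊔ b) (c ℕ.⊔ d) ≤k
        cd = ℕ.m⊔n≤o⇒n≤o (a ℕ.⊔ b) (c ℕ.⊔ d) ≤k
    in ℕ.m⊔n≤o⇒m≤o a b ab , ℕ.m⊔n≤o⇒n≤o a b ab , ℕ.m⊔n≤o⇒m≤o c d cd , ℕ.m⊔n≤o⇒n≤o c d cd

  bounded : ∀ x → Cauchy x →
    ∃ λ B → 0ℚ ℚ.< B × Eventually λ n → ∣ x n ∣ ℚ.≤ B
  bounded x cx =
    let (N , close) = cx 1ℚ (ℚ.positive⁻¹ 1ℚ)
    in ∣ x N ∣ ℚ.+ 1ℚ
     , ℚ.+-mono-≤-< 0≤∣ x N ∣ (ℚ.positive⁻¹ 1ℚ)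
     , N , λ n N≤n →
         subst (λ p → ∣ p ∣ ℚ.≤ ∣ x N ∣ ℚ.+ 1ℚ) (regroup (x N) (x n))
           (ℚ.≤-trans (ℚ.∣p+q∣≤∣p∣+∣q∣ (x N) (x n ℚ.- x N))
             (ℚ.+-monoʳ-≤ ∣ x N ∣ (ℚ.<⇒≤ (close n N N≤n ℕ.≤-refl))))
    where
    open +-*-Solver
    regroup : ∀ a b → a ℚ.+ (b ℚ.- a) ≡ b
    regroup = solve 2 (λ a b → a :+ (b :- a) := b) refl

constℝ : ℚ → ℝ
constℝ q = mkℝ (λ _ → q) λ δ δ>0 → 0 , λ _ _ _ _ →
  subst (λ p → ∣ p ∣ ℚ.< δ) (sym (ℚ.+-inverseʳ q)) δ>0

0ℝ 1ℝ : ℝ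
0ℝ = constℝ 0ℚ
1ℝ = constℝ 1ℚ

_+ℝ_ : ℝ → ℝ → ℝ
x +ℝ y = mkℝ (λ n → seq x n ℚ.+ seq y n) cauchy-+
  where
  open +-*-Solver
  regroup : ∀ a b c d → (a ℚ.- c) ℚ.+ (b ℚ.- d) ≡ (a ℚ.+ b) ℚ.- (c ℚ.+ d)
  regroup = solve 4 (λ a b c d → (a :- c) :+ (b :- d) := (a :+ b) :- (c :+ d)) refl
  cauchy-+ : Cauchy (λ n → seq x n ℚ.+ seq y n)
  cauchy-+ δ δ>0 =
    let (N , closeˣ)  = cauchy x (½ ℚ.* δ) (half-pos δ>0)
        (N′ , closeʸ) = cauchy y (½ ℚ.* δ) (half-pos δ>0)
    in N ℕ.⊔ N′ , λ m n ≤m ≤n →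
      subst (λ p → ∣ p ∣ ℚ.< δ) (regroup (seq x m) (seq y m) (seq x n) (seq y n))
        (∣+∣< (seq x m ℚ.- seq x n) (seq y m ℚ.- seq y n)
          (closeˣ m n (ℕ.m⊔n≤o⇒m≤o N N′ ≤m) (ℕ.m⊔n≤o⇒m≤o N N′ ≤n))
          (closeʸ m n (ℕ.m⊔n≤o⇒n≤o N N′ ≤m) (ℕ.m⊔n≤o⇒n≤o N N′ ≤n)))

-ℝ_ : ℝ → ℝ
-ℝ x = mkℝ (λ n → ℚ.- seq x n) cauchy-neg
  where
  open +-*-Solver
  regroup : ∀ a b → ℚ.- (a ℚ.- b) ≡ (ℚ.- a) ℚ.- (ℚ.- b)
  regroup = solve 2 (λ a b → :- (a :- b) := (:- a) :- (:- b)) refl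
  cauchy-neg : Cauchy (λ n → ℚ.- seq x n)
  cauchy-neg δ δ>0 =
    let (N , close) = cauchy x δ δ>0
    in N , λ m n ≤m ≤n →
      subst (ℚ._< δ)
        (trans (sym (ℚ.∣-p∣≡∣p∣ (seq x m ℚ.- seq x n)))
               (cong ∣_∣ (regroup (seq x m) (seq x n))))
        (close m n ≤m ≤n)

_*ℝ_ : ℝ → ℝ → ℝ
x *ℝ y = mkℝ (λ n → seq x n ℚ.* seq y n) cauchy-*
  where
  open +-*-Solver
  regroup : ∀ a b c d →
    a ℚ.* (b ℚ.- d) ℚ.+ d ℚ.* (a ℚ.- c) ≡ a ℚ.* b ℚ.- c ℚ.* d
  regroup = solve 4 (λ a b c d →
    a :* (b :- d) :+ d :* (a :- c) := a :* b :- c :* d) refl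
  combine : ∀ δ a b c d →
    ∣ a ℚ.* (b ℚ.- d) ∣ ℚ.< ½ ℚ.* δ → ∣ d ℚ.* (a ℚ.- c) ∣ ℚ.< ½ ℚ.* δ →
    ∣ a ℚ.* b ℚ.- c ℚ.* d ∣ ℚ.< δ
  combine δ a b c d p< q< = subst (λ p → ∣ p ∣ ℚ.< δ) (regroup a b c d)
    (∣+∣< (a ℚ.* (b ℚ.- d)) (d ℚ.* (a ℚ.- c)) p< q<)
  cauchy-* : Cauchy (λ n → seq x n ℚ.* seq y n)
  cauchy-* δ δ>0 =
    let (B , B>0 , N₁ , x≤B) = bounded (seq x) (cauchy x)
        (C , C>0 , N₂ , y≤C) = bounded (seq y) (cauchy y)
        (η , η>0 , smallˣ)   = ∣*∣< B>0 (half-pos δ>0)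
        (θ , θ>0 , smallʸ)   = ∣*∣< C>0 (half-pos δ>0)
        (N₃ , closeʸ)        = cauchy y η η>0
        (N₄ , closeˣ)        = cauchy x θ θ>0
    in (N₁ ℕ.⊔ N₂) ℕ.⊔ (N₃ ℕ.⊔ N₄) , λ m n ≤m ≤n →
      let (N₁≤m , _ , N₃≤m , N₄≤m) = ⊔-bounds N₁ N₂ N₃ N₄ ≤m
          (_ , N₂≤n , N₃≤n , N₄≤n) = ⊔-bounds N₁ N₂ N₃ N₄ ≤n
      in combine δ (seq x m) (seq y m) (seq x n) (seq y n)
           (smallˣ (seq x m) (seq y m ℚ.- seq y n) (x≤B m N₁≤m) (closeʸ m n N₃≤m N₃≤n))
           (smallʸ (seq y n) (seq x m ℚ.- seq x n) (y≤C n N₂≤n) (closeˣ m n N₄≤m N₄≤n))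

≃ℝ-refl : ∀ {x} → x ≃ℝ x
≃ℝ-refl {x} δ δ>0 = 0 , λ n _ →
  subst (λ p → ∣ p ∣ ℚ.< δ) (sym (ℚ.+-inverseʳ (seq x n))) δ>0

private
  p-0≡p : ∀ p → p ℚ.- 0ℚ ≡ p
  p-0≡p = ℚ.+-identityʳ

+ℝ-zero : ∀ x y → x ≃ℝ 0ℝ → y ≃ℝ 0ℝ → x +ℝ y ≃ℝ 0ℝ
+ℝ-zero x y x≃0 y≃0 δ δ>0 =
  let (N , smallˣ)  = x≃0 (½ ℚ.* δ) (half-pos δ>0)
      (N′ , smallʸ) = y≃0 (½ ℚ.* δ) (half-pos δ>0)
  in N ℕ.⊔ N′ , λ n ≤n →
    subst (λ p → ∣ p ∣ ℚ.< δ) (sym (p-0≡p (seq x n ℚ.+ seq y n)))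
      (∣+∣< (seq x n) (seq y n)
        (subst (λ p → ∣ p ∣ ℚ.< ½ ℚ.* δ) (p-0≡p (seq x n)) (smallˣ n (ℕ.m⊔n≤o⇒m≤o N N′ ≤n)))
        (subst (λ p → ∣ p ∣ ℚ.< ½ ℚ.* δ) (p-0≡p (seq y n)) (smallʸ n (ℕ.m⊔n≤o⇒n≤o N N′ ≤n))))

*ℝ-zero : ∀ x y → y ≃ℝ 0ℝ → x *ℝ y ≃ℝ 0ℝ
*ℝ-zero x y y≃0 δ δ>0 =
  let (B , B>0 , N , x≤B) = bounded (seq x) (cauchy x)
      (η , η>0 , small)   = ∣*∣< B>0 δ>0
      (N′ , smallʸ)       = y≃0 η η>0
  in N ℕ.⊔ N′ , λ n ≤n →
    subst (λ p → ∣ p ∣ ℚ.< δ) (sym (p-0≡p (seq x n ℚ.* seq y n)))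
      (small (seq x n) (seq y n) (x≤B n (ℕ.m⊔n≤o⇒m≤o N N′ ≤n))
        (subst (λ p → ∣ p ∣ ℚ.< η) (p-0≡p (seq y n)) (smallʸ n (ℕ.m⊔n≤o⇒n≤o N N′ ≤n))))

∑ : {A : Set} → List A → (A → ℝ) → ℝ
∑ xs f = foldr _+ℝ_ 0ℝ (map f xs)

∑-zero : ∀ {A : Set} (xs : List A) (f : A → ℝ) →
  (∀ x → x ∈ xs → f x ≃ℝ 0ℝ) → ∑ xs f ≃ℝ 0ℝ
∑-zero []       f f≃0 = ≃ℝ-refl {0ℝ}
∑-zero (x ∷ xs) f f≃0 =
  +ℝ-zero (f x) (∑ xs f) (f≃0 x (here refl)) (∑-zero xs f λ y → f≃0 y ∘ there)

record [0,1] : Set where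
  constructor mk[0,1]
  field
    value : ℝ
    lower : 0ℝ ≤ℝ value
    upper : value ≤ℝ 1ℝ

open [0,1] public using (value)

private
  const≤ : ∀ {p q} → p ℚ.≤ q → constℝ p ≤ℝ constℝ q
  const≤ {p} {q} p≤q δ δ>0 = 0 , λ _ _ →
    subst (ℚ._≤ q ℚ.+ δ) (ℚ.+-identityʳ p) (ℚ.+-mono-≤ p≤q (ℚ.<⇒≤ δ>0))

𝟙 : [0,1]
𝟙 = mk[0,1] 1ℝ (const≤ (ℚ.nonNegative⁻¹ 1ℚ)) (const≤ (ℚ.≤-refl {1ℚ}))

-- ℝ ∪ {+∞}: an element is given by its set of strict rational lower
-- bounds, that is, by an inhabited, downward closed and rounded set of
-- rationals; +∞ is the set of all rationals.  Unlike in ℝ,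
-- every sequence constructively has a supremum here.

record ℝ∞ : Set₁ where
  field
    Below      : ℚ → Set
    inhabited  : ∃ λ q → Below q
    downClosed : ∀ {p q} → p ℚ.< q → Below q → Below p
    rounded    : ∀ {p} → Below p → ∃ λ q → p ℚ.< q × Below q

open ℝ∞ public

infix 4 _≤∞_

_≤∞_ : ℝ∞ → ℝ∞ → Set
x ≤∞ y = ∀ q → Below x q → Below y q

private
  neg-neg : ∀ p → ℚ.- (ℚ.- p) ≡ p
  neg-neg = solve 1 (λ a → :- (:- a) := a) refl
    where open +-*-Solver

  p≤∣p∣ : ∀ p → p ℚ.≤ ∣ p ∣
  p≤∣p∣ p with ℚ.≤-total 0ℚ p
  ... | inj₁ 0≤p = ℚ.≤-reflexive (sym (ℚ.0≤p⇒∣p∣≡p 0≤p))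
  ... | inj₂ p≤0 = ℚ.≤-trans p≤0 0≤∣ p ∣

  -∣_∣≤ : ∀ p → ℚ.- ∣ p ∣ ℚ.≤ p
  -∣ p ∣≤ = subst (ℚ.- ∣ p ∣ ℚ.≤_) (neg-neg p)
    (ℚ.neg-antimono-≤ (subst (ℚ.- p ℚ.≤_) (ℚ.∣-p∣≡∣p∣ p) (p≤∣p∣ (ℚ.- p))))

  cancel : ∀ b → (ℚ.- b ℚ.- 1ℚ) ℚ.+ 1ℚ ≡ ℚ.- b
  cancel b = trans (ℚ.+-assoc (ℚ.- b) (ℚ.- 1ℚ) 1ℚ) (ℚ.+-identityʳ (ℚ.- b))

  <ℝ-down : ∀ {p q} x → p ℚ.< q → constℝ q <ℝ x → constℝ p <ℝ x
  <ℝ-down {p} {q} x p<q (δ , δ>0 , N , q<x) = δ , δ>0 , N , λ n N≤n →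
    ℚ.≤-trans (ℚ.+-monoˡ-≤ δ (ℚ.<⇒≤ p<q)) (q<x n N≤n)

  <ℝ-round : ∀ {p} x → constℝ p <ℝ x → ∃ λ q → p ℚ.< q × constℝ q <ℝ x
  <ℝ-round {p} x (δ , δ>0 , N , p<x) =
      p ℚ.+ ½ ℚ.* δ
    , subst (ℚ._< p ℚ.+ ½ ℚ.* δ) (ℚ.+-identityʳ p) (ℚ.+-monoʳ-< p (half-pos δ>0))
    , ½ ℚ.* δ , half-pos δ>0 , N , λ n N≤n →
        subst (ℚ._≤ seq x n)
          (sym (trans (ℚ.+-assoc p (½ ℚ.* δ) (½ ℚ.* δ)) (cong (p ℚ.+_) (half+half δ))))
          (p<x n N≤n)

sup : (ℕ → ℝ) → ℝ∞
sup s = record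
  { Below      = λ q → ∃ λ n → constℝ q <ℝ s n
  ; inhabited  = let (q , q<s₀) = minorant (s 0) in q , 0 , q<s₀
  ; downClosed = λ { p<q (n , q<s) → n , <ℝ-down (s n) p<q q<s }
  ; rounded    = λ { (n , p<s) →
      let (q , p<q , q<s) = <ℝ-round (s n) p<s in q , p<q , n , q<s }
  }
  where
  minorant : ∀ x → ∃ λ q → constℝ q <ℝ x
  minorant x =
    let (B , _ , N , x≤B) = bounded (seq x) (cauchy x)
    in ℚ.- B ℚ.- 1ℚ , 1ℚ , ℚ.positive⁻¹ 1ℚ , N , λ n N≤n →
       subst (ℚ._≤ seq x n) (sym (cancel B))
         (ℚ.≤-trans (ℚ.neg-antimono-≤ (x≤B n N≤n)) (-∣ seq x n ∣≤))

-- The sum of a series, valid for nonnegative terms only.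
∑∞ : (ℕ → ℝ) → ℝ∞
∑∞ f = sup λ n → ∑ (upTo n) f

-- λ-terms up to α-equivalence, in de Bruijn notation: an index that
-- exceeds the number of enclosing abstractions denotes a free variable.

infixl 7 _·_
infixr 6 ƛ_

data Λ : Set where
  var : ℕ → Λ
  _·_ : Λ → Λ → Λ
  ƛ_  : Λ → Λ

infix 4 _≟_

_≟_ : DecidableEquality Λ
var x   ≟ var y with x ℕ.≟ y
... | yes refl = yes refl
... | no  x≢y  = no λ { refl → x≢y refl }
var _   ≟ _ · _ = no λ ()
var _   ≟ ƛ _   = no λ ()
_ · _   ≟ var _ = no λ ()
M · N   ≟ P · Q with M ≟ P | N ≟ Q
... | yes refl | yes refl = yes refl
... | no M≢P   | _        = no λ { refl → M≢P refl }
... | _        | no N≢Q   = no λ { refl → N≢Q refl }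
_ · _   ≟ ƛ _   = no λ ()
ƛ _     ≟ var _ = no λ ()
ƛ _     ≟ _ · _ = no λ ()
ƛ M     ≟ ƛ N with M ≟ N
... | yes refl = yes refl
... | no  M≢N  = no λ { refl → M≢N refl }

liftʳ : (ℕ → ℕ) → ℕ → ℕ
liftʳ ϱ zero    = zero
liftʳ ϱ (suc x) = suc (ϱ x)

rename : (ℕ → ℕ) → Λ → Λ
rename ϱ (var x) = var (ϱ x)
rename ϱ (M · N) = rename ϱ M · rename ϱ N
rename ϱ (ƛ M)   = ƛ rename (liftʳ ϱ) M

liftˢ : (ℕ → Λ) → ℕ → Λ
liftˢ σ zero    = var zero
liftˢ σ (suc x) = rename suc (σ x)

substitute : (ℕ → Λ) → Λ → Λ
substitute σ (var x) = σ x
substitute σ (M · N) = substitute σ M · substitute σ N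
substitute σ (ƛ M)   = ƛ substitute (liftˢ σ) M

_,id : Λ → ℕ → Λ
(N ,id) zero    = N
(N ,id) (suc x) = var x

infix 8 _[_]

_[_] : Λ → Λ → Λ
M [ N ] = substitute (N ,id) M

infix 4 _∈FV_ _⊑_

data _∈FV_ : ℕ → Λ → Set where
  var  : ∀ {x} → x ∈FV var x
  appˡ : ∀ {x M N} → x ∈FV M → x ∈FV M · N
  appʳ : ∀ {x M N} → x ∈FV N → x ∈FV M · N
  lam  : ∀ {x M} → suc x ∈FV M → x ∈FV ƛ M

data _⊑_ (P : Λ) : Λ → Set where
  refl : P ⊑ P
  appˡ : ∀ {M N} → P ⊑ M → P ⊑ M · N
  appʳ : ∀ {M N} → P ⊑ N → P ⊑ M · N
  lam  : ∀ {M} → P ⊑ M → P ⊑ ƛ M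

Λᴵ : Λ → Set
Λᴵ M = ∀ N → ƛ N ⊑ M → zero ∈FV N

data Redex : Λ → Set where
  root : ∀ {M N} → Redex ((ƛ M) · N)
  appˡ : ∀ {M N} → Redex M → Redex (M · N)
  appʳ : ∀ {M N} → Redex N → Redex (M · N)
  lam  : ∀ {M} → Redex M → Redex (ƛ M)

fire : ∀ {M} → Redex M → Λ
fire (root {M} {N})     = M [ N ]
fire (appˡ {N = N} r)   = fire r · N
fire (appʳ {M = M} r)   = M · fire r
fire (lam r)            = ƛ fire r

infix 4 _⟶β_

_⟶β_ : Λ → Λ → Set
M ⟶β N = ∃ λ (r : Redex M) → fire r ≡ N

Reducible : Λ → Set
Reducible M = ∃ λ N → M ⟶β N

redexAtRoot : ∀ M N → List (Redex (M · N))
redexAtRoot (ƛ _) N = root ∷ []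
redexAtRoot _     N = []

redexes : ∀ M → List (Redex M)
redexes (var x) = []
redexes (ƛ M)   = map lam (redexes M)
redexes (M · N) = redexAtRoot M N ++ map appˡ (redexes M) ++ map appʳ (redexes N)

∈-redexes : ∀ {M} (r : Redex M) → r ∈ redexes M
∈-redexes root               = here refl
∈-redexes (lam r)            = ∈-map⁺ lam (∈-redexes r)
∈-redexes (appˡ {M} {N} r)   =
  ∈-++⁺ʳ (redexAtRoot M N) (∈-++⁺ˡ (∈-map⁺ appˡ (∈-redexes r)))
∈-redexes (appʳ {M} {N} r)   =
  ∈-++⁺ʳ (redexAtRoot M N) (∈-++⁺ʳ (map appˡ (redexes M)) (∈-map⁺ appʳ (∈-redexes r)))

reducible? : ∀ M → Dec (Reducible M)
reducible? M with redexes M | ∈-redexes {M}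
... | []    | complete = no λ { (_ , r , _) → case-[] (complete r) }
  where
  case-[] : ∀ {A B : Set} {x : A} → x ∈ [] → B
  case-[] ()
... | r ∷ _ | _        = yes (fire r , r , refl)

-- Terms are written with all parentheses, as x, (MN) and (λx.M), every
-- variable counting for one symbol.
∥_∥ : Λ → ℕ
∥ var x ∥ = 1
∥ M · N ∥ = 2 ℕ.+ (∥ M ∥ ℕ.+ ∥ N ∥)
∥ ƛ M ∥   = 5 ℕ.+ ∥ M ∥

-- The number of symbols that precede the redex in the written term.
position : ∀ {M} → Redex M → ℕ
position root             = 0
position (appˡ r)         = 1 ℕ.+ position r
position (appʳ {M = M} r) = 1 ℕ.+ ∥ M ∥ ℕ.+ position r
position (lam r)          = 4 ℕ.+ position r

-- The redex contained in a proof of reducibility only serves to seed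
-- argmin and argmax; distinct redexes have distinct positions.
LO RI : ∀ M → Reducible M → Λ
LO M (_ , r , _) = fire (argmin position r (redexes M))
RI M (_ , r , _) = fire (argmax position r (redexes M))

-- Finitely supported functions Λ → ℝ.  All the distributions in play
-- are of this kind, so that the sums over Λ are finite.

record FinSupp : Set where
  field
    mass    : Λ → ℝ
    support : List Λ
    unique  : Unique support
    outside : ∀ N → N ∉ support → mass N ≃ℝ 0ℝ

open FinSupp public

total : FinSupp → ℝ
total ρ = ∑ (support ρ) (mass ρ)

zeroᶠ : FinSupp
zeroᶠ = record
  { mass    = λ _ → 0ℝ
  ; support = []
  ; unique  = []
  ; outside = λ _ _ → ≃ℝ-refl {0ℝ}
  }

dirac : Λ → FinSupp
dirac M = record
  { mass    = mass′
  ; support = M ∷ []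
  ; unique  = [] ∷ []
  ; outside = outside′
  }
  where
  mass′ : Λ → ℝ
  mass′ N with M ≟ N
  ... | yes _ = 1ℝ
  ... | no  _ = 0ℝ
  outside′ : ∀ N → N ∉ M ∷ [] → mass′ N ≃ℝ 0ℝ
  outside′ N N∉ with M ≟ N
  ... | yes M≡N = ⊥-elim (N∉ (here (sym M≡N)))
  ... | no  _   = ≃ℝ-refl {0ℝ}

infixl 6 _+ᶠ_
infixr 7 _*ᶠ_

_+ᶠ_ : FinSupp → FinSupp → FinSupp
ρ +ᶠ τ = record
  { mass    = λ N → mass ρ N +ℝ mass τ N
  ; support = deduplicate _≟_ (support ρ ++ support τ)
  ; unique  = deduplicate-! _≟_ (support ρ ++ support τ)
  ; outside = λ N N∉ → +ℝ-zero (mass ρ N) (mass τ N)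
      (outside ρ N (N∉ ∘ ∈-deduplicate⁺ _≟_ ∘ ∈-++⁺ˡ))
      (outside τ N (N∉ ∘ ∈-deduplicate⁺ _≟_ ∘ ∈-++⁺ʳ (support ρ)))
  }

_*ᶠ_ : ℝ → FinSupp → FinSupp
a *ᶠ ρ = record
  { mass    = λ N → a *ℝ mass ρ N
  ; support = support ρ
  ; unique  = unique ρ
  ; outside = λ N N∉ → *ℝ-zero a (mass ρ N) (outside ρ N N∉)
  }

P[_] : [0,1] → ∀ M → Reducible M → FinSupp
P[ ε ] M red = value ε *ᶠ dirac (LO M red) +ᶠ (1ℝ +ℝ -ℝ value ε) *ᶠ dirac (RI M red)

-- The mass of ℙ[ ε ] M at N is the probability of M → N.
ℙ[_] : [0,1] → Λ → FinSupp
ℙ[ ε ] M with reducible? M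
... | yes red = P[ ε ] M red
... | no  _   = zeroᶠ

step : [0,1] → FinSupp → FinSupp
step ε ρ = record
  { mass    = λ N → ∑ (support ρ) λ L → mass ρ L *ℝ mass (ℙ[ ε ] L) N
  ; support = deduplicate _≟_ successors
  ; unique  = deduplicate-! _≟_ successors
  ; outside = λ N N∉ → ∑-zero (support ρ) _ λ L L∈ →
      *ℝ-zero (mass ρ L) (mass (ℙ[ ε ] L) N)
        (outside (ℙ[ ε ] L) N λ N∈ →
          N∉ (∈-deduplicate⁺ _≟_
            (∈-concatMap⁺ (support ∘ ℙ[ ε ])
              (Any.map (λ { refl → N∈ }) L∈))))
  }
  where
  successors : List Λ
  successors = concatMap (support ∘ ℙ[ ε ]) (support ρ)

computation : [0,1] → Λ → ℕ → FinSupp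
computation ε M zero    = dirac M
computation ε M (suc i) = step ε (computation ε M i)

ExpLen : Λ → [0,1] → ℝ∞
ExpLen M ε = ∑∞ λ i → total (computation ε M (suc i))

module Submission where

-- In the λI-calculus no contraction erases its argument.  A step from M other than the
-- leftmost one leaves exactly one residual of the leftmost redex, again
-- leftmost, whereas contracting the leftmost redex leaves at least one
-- residual of the other redex.  By induction on the length of the
-- leftmost reduction to normal form, it is therefore the longest of all
-- reductions from M.  Hence, for each i, either the leftmost reduction has an
-- i-th step, so that |ρᵢ| = 1 at ε = 1 and |ρᵢ| ≤ 1 elsewhere, or no
-- reduction has one and ρᵢ has empty support for every ε.

open import Defs

open import Data.Empty using (⊥-elim)
open import Data.List using (List; []; _∷_; map; foldr; upTo)
open import Data.List.Extrema.Nat using (argmin; argmax; f[argmin]≤f[xs])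
open import Data.List.Membership.Propositional using (_∈_; _∉_; find)
open import Data.List.Membership.Propositional.Properties
  using (∈-concatMap⁺; ∈-concatMap⁻; ∈-deduplicate⁺; ∈-deduplicate⁻)
import Data.List.Relation.Unary.All as All
open import Data.List.Relation.Unary.AllPairs using (_∷_)
open import Data.List.Relation.Unary.Any as Any using (here; there)
open import Data.List.Relation.Unary.Unique.Propositional using (Unique)
open import Data.Nat as ℕ using (ℕ; zero; suc)
import Data.Nat.Properties as ℕ
open import Data.Product using (∃; ∃₂; _×_; _,_)
open import Data.Rational as ℚ using (ℚ; 0ℚ; 1ℚ; ½; ∣_∣)
import Data.Rational.Properties as ℚ
open import Data.Rational.Solver using (module +-*-Solver)
open import Data.Sum using (_⊎_; inj₁; inj₂; [_,_]′; map₂)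
open import Function using (_∘_)
open import Relation.Binary.PropositionalEquality
  using (_≡_; _≢_; refl; sym; trans; cong; cong₂; subst; module ≡-Reasoning)
open import Relation.Nullary using (¬_; yes; no)

-- Substitution

substitute-rename : ∀ {σ ϱ υ} → (∀ x → σ (ϱ x) ≡ υ x) →
  ∀ M → substitute σ (rename ϱ M) ≡ substitute υ M
substitute-rename eq (var x) = eq x
substitute-rename eq (M · N) = cong₂ _·_ (substitute-rename eq M) (substitute-rename eq N)
substitute-rename eq (ƛ M)   = cong ƛ_ (substitute-rename
  (λ { zero → refl ; (suc x) → cong (rename suc) (eq x) }) M)

rename-as-substitute : ∀ {ϱ υ} → (∀ x → var (ϱ x) ≡ υ x) →
  ∀ M → rename ϱ M ≡ substitute υ M
rename-as-substitute eq (var x) = eq x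
rename-as-substitute eq (M · N) =
  cong₂ _·_ (rename-as-substitute eq M) (rename-as-substitute eq N)
rename-as-substitute eq (ƛ M)   = cong ƛ_ (rename-as-substitute
  (λ { zero → refl ; (suc x) → cong (rename suc) (eq x) }) M)

-- Renamings are turned into substitutions, where composition is already available; both sides then
-- become the substitution sending `x` to `var (suc (ϱ x))`.
rename-suc-comm : ∀ ϱ M → rename (liftʳ ϱ) (rename suc M) ≡ rename suc (rename ϱ M)
rename-suc-comm ϱ M = begin
  rename (liftʳ ϱ) (rename suc M)             ≡⟨ rename-as-substitute (λ _ → refl) (rename suc M) ⟩
  substitute (λ x → var (liftʳ ϱ x)) (rename suc M)   ≡⟨ substitute-rename (λ _ → refl) M ⟩
  substitute (λ x → var (suc (ϱ x))) M                ≡⟨ substitute-rename (λ _ → refl) M ⟨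
  substitute (λ x → var (suc x)) (rename ϱ M)         ≡⟨ rename-as-substitute (λ _ → refl) (rename ϱ M) ⟨
  rename suc (rename ϱ M)                     ∎
  where open ≡-Reasoning

rename-substitute : ∀ {ϱ σ υ} → (∀ x → rename ϱ (σ x) ≡ υ x) →
  ∀ M → rename ϱ (substitute σ M) ≡ substitute υ M
rename-substitute eq (var x) = eq x
rename-substitute eq (M · N) =
  cong₂ _·_ (rename-substitute eq M) (rename-substitute eq N)
rename-substitute {ϱ} {σ} eq (ƛ M) = cong ƛ_ (rename-substitute
  (λ { zero    → refl
     ; (suc x) → trans (rename-suc-comm ϱ (σ x)) (cong (rename suc) (eq x)) }) M)

substitute-substitute : ∀ {τ σ υ} → (∀ x → substitute τ (σ x) ≡ υ x) →
  ∀ M → substitute τ (substitute σ M) ≡ substitute υ M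
substitute-substitute eq (var x) = eq x
substitute-substitute eq (M · N) =
  cong₂ _·_ (substitute-substitute eq M) (substitute-substitute eq N)
substitute-substitute {τ} {σ} eq (ƛ M) = cong ƛ_ (substitute-substitute
  (λ { zero    → refl
     ; (suc x) → trans (substitute-rename (λ _ → refl) (σ x))
         (trans (sym (rename-substitute (λ _ → refl) (σ x))) (cong (rename suc) (eq x))) }) M)

substitute-var : ∀ {σ} → (∀ x → σ x ≡ var x) → ∀ M → substitute σ M ≡ M
substitute-var eq (var x) = eq x
substitute-var eq (M · N) = cong₂ _·_ (substitute-var eq M) (substitute-var eq N)
substitute-var eq (ƛ M)   = cong ƛ_ (substitute-var
  (λ { zero → refl ; (suc x) → cong (rename suc) (eq x) }) M)

-- The substitution lemma. Each side fuses into one simultaneous substitution in `M`; the two agree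
-- at `suc x` because instantiating index zero undoes the weakening of `σ x`.
substitute-[] : ∀ σ M N →
  substitute σ (M [ N ]) ≡ substitute (liftˢ σ) M [ substitute σ N ]
substitute-[] σ M N = trans
  (substitute-substitute (λ _ → refl) M)
  (sym (substitute-substitute
    (λ { zero    → refl
       ; (suc x) → trans (substitute-rename (λ _ → refl) (σ x))
                         (substitute-var (λ _ → refl) (σ x)) }) M))

-- Reduction

data Iterate (R : Λ → Λ → Set) : ℕ → Λ → Λ → Set where
  []  : ∀ {M} → Iterate R 0 M M
  _∷_ : ∀ {n L M N} → R L M → Iterate R n M N → Iterate R (suc n) L N

infixr 5 _∷_ _⊕_

_⊕_ : ∀ {R m n L M N} → Iterate R m L M → Iterate R n M N → Iterate R (m ℕ.+ n) L N
[]       ⊕ ts = ts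
(s ∷ ss) ⊕ ts = s ∷ (ss ⊕ ts)

snoc : ∀ {R n L M N} → Iterate R n L M → R M N → Iterate R (suc n) L N
snoc []       t = t ∷ []
snoc (s ∷ ss) t = s ∷ snoc ss t

unsnoc : ∀ {R n L N} → Iterate R (suc n) L N → ∃ λ M → Iterate R n L M × R M N
unsnoc (s ∷ [])          = _ , [] , s
unsnoc (s ∷ ss@(_ ∷ _)) = let (_ , ts , t) = unsnoc ss in _ , s ∷ ts , t

map-Iterate : ∀ {R S : Λ → Λ → Set} (f : Λ → Λ) → (∀ {M N} → R M N → S (f M) (f N)) →
  ∀ {n M N} → Iterate R n M N → Iterate S n (f M) (f N)
map-Iterate f g []       = []
map-Iterate f g (s ∷ ss) = g s ∷ map-Iterate f g ss

infix 4 _⟶β[_]_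

_⟶β[_]_ : Λ → ℕ → Λ → Set
M ⟶β[ n ] N = Iterate _⟶β_ n M N

⟶β-appˡ : ∀ {M M′ N} → M ⟶β M′ → M · N ⟶β M′ · N
⟶β-appˡ (r , refl) = appˡ r , refl

⟶β-appʳ : ∀ {M N N′} → N ⟶β N′ → M · N ⟶β M · N′
⟶β-appʳ (r , refl) = appʳ r , refl

⟶β-lam : ∀ {M M′} → M ⟶β M′ → ƛ M ⟶β ƛ M′
⟶β-lam (r , refl) = lam r , refl

⟶β-substitute : ∀ σ {M} (r : Redex M) → substitute σ M ⟶β substitute σ (fire r)
⟶β-substitute σ (root {M} {N}) = root , sym (substitute-[] σ M N)
⟶β-substitute σ (appˡ r)       = ⟶β-appˡ (⟶β-substitute σ r)
⟶β-substitute σ (appʳ r)       = ⟶β-appʳ (⟶β-substitute σ r)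
⟶β-substitute σ (lam r)        = ⟶β-lam (⟶β-substitute (liftˢ σ) r)

⟶β-rename : ∀ ϱ {M N} → M ⟶β N → rename ϱ M ⟶β rename ϱ N
⟶β-rename ϱ {M} (r , refl)
  rewrite rename-as-substitute {ϱ} (λ _ → refl) M
        | rename-as-substitute {ϱ} (λ _ → refl) (fire r) = ⟶β-substitute (var ∘ ϱ) r

appˡ* : ∀ {n M M′} N → M ⟶β[ n ] M′ → M · N ⟶β[ n ] M′ · N
appˡ* N = map-Iterate (_· N) ⟶β-appˡ

appʳ* : ∀ {n N N′} M → N ⟶β[ n ] N′ → M · N ⟶β[ n ] M · N′
appʳ* M = map-Iterate (M ·_) ⟶β-appʳ

lam* : ∀ {n M M′} → M ⟶β[ n ] M′ → ƛ M ⟶β[ n ] ƛ M′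
lam* = map-Iterate ƛ_ ⟶β-lam

liftˢ* : ∀ {σ τ} → (∀ x → ∃ λ n → σ x ⟶β[ n ] τ x) →
  ∀ x → ∃ λ n → liftˢ σ x ⟶β[ n ] liftˢ τ x
liftˢ* ss zero    = 0 , []
liftˢ* ss (suc x) = let (n , s) = ss x in n , map-Iterate (rename suc) (⟶β-rename suc) s

substitute* : ∀ {σ τ} → (∀ x → ∃ λ n → σ x ⟶β[ n ] τ x) →
  ∀ M → ∃ λ n → substitute σ M ⟶β[ n ] substitute τ M
substitute* ss (var x) = ss x
substitute* {σ} {τ} ss (M · N) =
  let (m , s) = substitute* ss M
      (n , t) = substitute* ss N
  in m ℕ.+ n , appˡ* (substitute σ N) s ⊕ appʳ* (substitute τ M) t
substitute* ss (ƛ M) = let (n , s) = substitute* (liftˢ* ss) M in n , lam* s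

-- The witness `x ∈FV M` points at one copy of `σ x`, which contributes a step; the other
-- occurrences may contribute any number. This is how a redex in an argument survives contraction of
-- the surrounding redex in the λI-calculus.
substitute⁺ : ∀ {σ τ} → (∀ x → ∃ λ n → σ x ⟶β[ n ] τ x) →
  ∀ {x M} → x ∈FV M → (∃ λ n → σ x ⟶β[ suc n ] τ x) →
  ∃ λ n → substitute σ M ⟶β[ suc n ] substitute τ M
substitute⁺ ss var s = s
substitute⁺ {σ} {τ} ss (appˡ {M = M} {N} x∈) s =
  let (m , t) = substitute⁺ ss x∈ s
      (n , u) = substitute* ss N
  in m ℕ.+ n , appˡ* (substitute σ N) t ⊕ appʳ* (substitute τ M) u
substitute⁺ {σ} {τ} ss (appʳ {M = M} {N} x∈) s =
  let (m , t) = substitute* ss M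
      (n , u) = substitute⁺ ss x∈ s
  in m ℕ.+ n , subst (λ k → substitute σ (M · N) ⟶β[ k ] substitute τ (M · N)) (ℕ.+-suc m n)
       (appˡ* (substitute σ N) t ⊕ appʳ* (substitute τ M) u)
substitute⁺ ss (lam x∈) (n , s) =
  let (m , t) = substitute⁺ (liftˢ* ss) x∈ (n , map-Iterate (rename suc) (⟶β-rename suc) s)
  in m , lam* t

-- The λI-calculus

∈FV-rename : ∀ {ϱ x M} → x ∈FV M → ϱ x ∈FV rename ϱ M
∈FV-rename var       = var
∈FV-rename (appˡ x∈) = appˡ (∈FV-rename x∈)
∈FV-rename (appʳ x∈) = appʳ (∈FV-rename x∈)
∈FV-rename (lam x∈)  = lam (∈FV-rename x∈)

∈FV-substitute : ∀ {σ x y M} → x ∈FV M → y ∈FV σ x → y ∈FV substitute σ M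
∈FV-substitute var       y∈ = y∈
∈FV-substitute (appˡ x∈) y∈ = appˡ (∈FV-substitute x∈ y∈)
∈FV-substitute (appʳ x∈) y∈ = appʳ (∈FV-substitute x∈ y∈)
∈FV-substitute (lam x∈)  y∈ = lam (∈FV-substitute x∈ (∈FV-rename y∈))

Λᴵ-appˡ : ∀ {M N} → Λᴵ (M · N) → Λᴵ M
Λᴵ-appˡ i P = i P ∘ appˡ

Λᴵ-appʳ : ∀ {M N} → Λᴵ (M · N) → Λᴵ N
Λᴵ-appʳ i P = i P ∘ appʳ

Λᴵ-lam : ∀ {M} → Λᴵ (ƛ M) → Λᴵ M
Λᴵ-lam i P = i P ∘ lam

Λᴵ-rename : ∀ ϱ M → Λᴵ M → Λᴵ (rename ϱ M)
Λᴵ-rename ϱ (M · N) i P (appˡ ⊑M) = Λᴵ-rename ϱ M (Λᴵ-appˡ i) P ⊑M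
Λᴵ-rename ϱ (M · N) i P (appʳ ⊑N) = Λᴵ-rename ϱ N (Λᴵ-appʳ i) P ⊑N
Λᴵ-rename ϱ (ƛ M)   i _ refl      = ∈FV-rename (i M refl)
Λᴵ-rename ϱ (ƛ M)   i P (lam ⊑M)  = Λᴵ-rename (liftʳ ϱ) M (Λᴵ-lam i) P ⊑M

Λᴵ-var : ∀ {x} → Λᴵ (var x)
Λᴵ-var _ ()

Λᴵ-liftˢ : ∀ {σ} → (∀ x → Λᴵ (σ x)) → ∀ x → Λᴵ (liftˢ σ x)
Λᴵ-liftˢ     j zero    = Λᴵ-var
Λᴵ-liftˢ {σ} j (suc x) = Λᴵ-rename suc (σ x) (j x)

Λᴵ-substitute : ∀ {σ} M → Λᴵ M → (∀ x → Λᴵ (σ x)) → Λᴵ (substitute σ M)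
Λᴵ-substitute (var x) i j             = j x
Λᴵ-substitute (M · N) i j P (appˡ ⊑M) = Λᴵ-substitute M (Λᴵ-appˡ i) j P ⊑M
Λᴵ-substitute (M · N) i j P (appʳ ⊑N) = Λᴵ-substitute N (Λᴵ-appʳ i) j P ⊑N
Λᴵ-substitute (ƛ M)   i j _ refl      = ∈FV-substitute (i M refl) var
Λᴵ-substitute (ƛ M)   i j P (lam ⊑M)  = Λᴵ-substitute M (Λᴵ-lam i) (Λᴵ-liftˢ j) P ⊑M

-- At the root, a variable of the argument is kept because the bound variable occurs in the body.
-- Closure of `Λᴵ` under reduction rests on this: a step below an abstraction must not lose the
-- bound variable.
∈FV-fire : ∀ {M} → Λᴵ M → (r : Redex M) → ∀ {x} → x ∈FV M → x ∈FV fire r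
∈FV-fire i root           (appˡ (lam x∈)) = ∈FV-substitute x∈ var
∈FV-fire i (root {M})     (appʳ x∈)       = ∈FV-substitute (i M (appˡ refl)) x∈
∈FV-fire i (appˡ r)       (appˡ x∈)       = appˡ (∈FV-fire (Λᴵ-appˡ i) r x∈)
∈FV-fire i (appˡ r)       (appʳ x∈)       = appʳ x∈
∈FV-fire i (appʳ r)       (appˡ x∈)       = appˡ x∈
∈FV-fire i (appʳ r)       (appʳ x∈)       = appʳ (∈FV-fire (Λᴵ-appʳ i) r x∈)
∈FV-fire i (lam r)        (lam x∈)        = lam (∈FV-fire (Λᴵ-lam i) r x∈)

Λᴵ-fire : ∀ {M} → Λᴵ M → (r : Redex M) → Λᴵ (fire r)
Λᴵ-fire i (root {M} {N}) = Λᴵ-substitute M (Λᴵ-lam (Λᴵ-appˡ i))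
  λ { zero → Λᴵ-appʳ i ; (suc _) → Λᴵ-var }
Λᴵ-fire i (appˡ r)    P (appˡ ⊑M) = Λᴵ-fire (Λᴵ-appˡ i) r P ⊑M
Λᴵ-fire i (appˡ r)    P (appʳ ⊑N) = i P (appʳ ⊑N)
Λᴵ-fire i (appʳ r)    P (appˡ ⊑M) = i P (appˡ ⊑M)
Λᴵ-fire i (appʳ r)    P (appʳ ⊑N) = Λᴵ-fire (Λᴵ-appʳ i) r P ⊑N
Λᴵ-fire i (lam {M} r) _ refl      = ∈FV-fire (Λᴵ-lam i) r (i M refl)
Λᴵ-fire i (lam r)     P (lam ⊑M)  = Λᴵ-fire (Λᴵ-lam i) r P ⊑M

-- The leftmost-outermost strategy

infix 4 _⟶ˡ_ _⟶ˡ[_]_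

-- A term that is not an abstraction and has a redex is an application,
-- whence the shape of the function part in appˡ.
data _⟶ˡ_ : Λ → Λ → Set where
  root : ∀ {M N} → (ƛ M) · N ⟶ˡ M [ N ]
  appˡ : ∀ {L M M′ N} → L · M ⟶ˡ M′ → (L · M) · N ⟶ˡ M′ · N
  appʳ : ∀ {M N N′} → (∀ P → M ≢ ƛ P) → ¬ Redex M → N ⟶ˡ N′ → M · N ⟶ˡ M · N′
  lam  : ∀ {M M′} → M ⟶ˡ M′ → ƛ M ⟶ˡ ƛ M′

_⟶ˡ[_]_ : Λ → ℕ → Λ → Set
M ⟶ˡ[ n ] N = Iterate _⟶ˡ_ n M N

⟶ˡ⇒redex : ∀ {M N} → M ⟶ˡ N → Redex M
⟶ˡ⇒redex root         = root
⟶ˡ⇒redex (appˡ s)     = appˡ (⟶ˡ⇒redex s)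
⟶ˡ⇒redex (appʳ _ _ s) = appʳ (⟶ˡ⇒redex s)
⟶ˡ⇒redex (lam s)      = lam (⟶ˡ⇒redex s)

⟶ˡ-deterministic : ∀ {M N N′} → M ⟶ˡ N → M ⟶ˡ N′ → N ≡ N′
⟶ˡ-deterministic root           root           = refl
⟶ˡ-deterministic root           (appʳ ≢ƛ _ _)  = ⊥-elim (≢ƛ _ refl)
⟶ˡ-deterministic (appˡ s)       (appˡ t)       = cong (_· _) (⟶ˡ-deterministic s t)
⟶ˡ-deterministic (appˡ s)       (appʳ _ nf _)  = ⊥-elim (nf (⟶ˡ⇒redex s))
⟶ˡ-deterministic (appʳ ≢ƛ _ _)  root           = ⊥-elim (≢ƛ _ refl)
⟶ˡ-deterministic (appʳ _ nf _)  (appˡ t)       = ⊥-elim (nf (⟶ˡ⇒redex t))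
⟶ˡ-deterministic (appʳ _ _ s)   (appʳ _ _ t)   = cong (_ ·_) (⟶ˡ-deterministic s t)
⟶ˡ-deterministic (lam s)        (lam t)        = cong ƛ_ (⟶ˡ-deterministic s t)

⟶ˡ[]-deterministic : ∀ {n M N N′} → M ⟶ˡ[ n ] N → M ⟶ˡ[ n ] N′ → N ≡ N′
⟶ˡ[]-deterministic []       []       = refl
⟶ˡ[]-deterministic (s ∷ ss) (t ∷ ts) with refl ← ⟶ˡ-deterministic s t =
  ⟶ˡ[]-deterministic ss ts

-- Serves to place every redex of a function part strictly before every redex of its argument.
position<∥∥ : ∀ {M} (r : Redex M) → position r ℕ.< ∥ M ∥
position<∥∥ root = ℕ.s≤s ℕ.z≤n
position<∥∥ (appˡ {M} {N} r) = ℕ.s≤s (ℕ.≤-trans (position<∥∥ r)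
  (ℕ.≤-trans (ℕ.m≤m+n ∥ M ∥ ∥ N ∥) (ℕ.n≤1+n _)))
position<∥∥ (appʳ {M} r) = ℕ.s≤s (ℕ.s≤s (ℕ.+-monoʳ-≤ ∥ M ∥ (ℕ.<⇒≤ (position<∥∥ r))))
position<∥∥ (lam r) = ℕ.+-monoʳ-≤ 4 (ℕ.m≤n⇒m≤1+n (position<∥∥ r))

-- Links the positional definition of `LO` to the inductive strategy: minimality passes to the
-- subterm containing `r`, since the positions of redexes in that subterm are all shifted by the
-- same constant.
leftmost⇒⟶ˡ : ∀ {M} (r : Redex M) → (∀ (s : Redex M) → position r ℕ.≤ position s) → M ⟶ˡ fire r
leftmost⇒⟶ˡ root _ = root
leftmost⇒⟶ˡ (lam r) r≤ = lam (leftmost⇒⟶ˡ r λ s → ℕ.+-cancelˡ-≤ 4 _ _ (r≤ (lam s)))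
-- With an abstraction as function part, the whole term is a redex at position 0, before `r`.
leftmost⇒⟶ˡ (appˡ {ƛ M} r) r≤ with () ← r≤ root
leftmost⇒⟶ˡ (appˡ {M₁ · M₂} r) r≤ =
  appˡ (leftmost⇒⟶ˡ r λ s → ℕ.+-cancelˡ-≤ 1 _ _ (r≤ (appˡ s)))
leftmost⇒⟶ˡ (appʳ {M} r) r≤ = appʳ
  (λ { P refl → ℕ.n≮0 (r≤ root) })
  (λ s → ℕ.<⇒≱ (position<∥∥ s) (ℕ.≤-trans (ℕ.m≤m+n ∥ M ∥ (position r)) (ℕ.s≤s⁻¹ (r≤ (appˡ s)))))
  (leftmost⇒⟶ˡ r λ s → ℕ.+-cancelˡ-≤ (1 ℕ.+ ∥ M ∥) _ _ (r≤ (appʳ s)))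

⟶ˡ-LO : ∀ M red → M ⟶ˡ LO M red
⟶ˡ-LO M (_ , r , _) = leftmost⇒⟶ˡ (argmin position r (redexes M)) λ s →
  All.lookup (f[argmin]≤f[xs] r (redexes M)) (∈-redexes s)

-- Leftmost reductions are longest in the λI-calculus

-- Unless the two steps coincide, the leftmost redex has one residual after `r`, still leftmost,
-- while `r` has `suc n` steps of residuals after the leftmost step. That this number is positive is
-- the contribution of `Λᴵ`.
commute : ∀ {M M′} → Λᴵ M → M ⟶ˡ M′ → (r : Redex M) →
  fire r ≡ M′ ⊎ ∃ λ N → fire r ⟶ˡ N × ∃ λ n → M′ ⟶β[ suc n ] N
commute i root root = inj₁ refl
commute i (root {M} {N}) (appˡ (lam r)) = inj₂
  (_ , root , 0 , ⟶β-substitute (N ,id) r ∷ [])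
-- The redex `r` is copied once per occurrence of the bound variable, and there is at least one.
commute i (root {M} {N}) (appʳ r) = inj₂
  (_ , root , substitute⁺ {N ,id} {fire r ,id}
     (λ { zero → 1 , (r , refl) ∷ [] ; (suc _) → 0 , [] })
     (i M (appˡ refl)) (0 , (r , refl) ∷ []))
-- Contracting the root of the function part could create an abstraction and so a new leftmost
-- redex, but there both steps agree. Any other redex leaves the function part an application, as
-- `appˡ` requires; hence the split on the redex.
commute i (appˡ root) (appˡ root) = inj₁ refl
commute i (appˡ (appʳ ≢ƛ _ _)) (appˡ root) = ⊥-elim (≢ƛ _ refl)
commute i (appˡ {N = N} s) (appˡ (appˡ r)) with commute (Λᴵ-appˡ i) s (appˡ r)
... | inj₁ eq              = inj₁ (cong (_· N) eq)
... | inj₂ (_ , t , n , u) = inj₂ (_ , appˡ t , n , appˡ* N u)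
commute i (appˡ {N = N} s) (appˡ (appʳ r)) with commute (Λᴵ-appˡ i) s (appʳ r)
... | inj₁ eq              = inj₁ (cong (_· N) eq)
... | inj₂ (_ , t , n , u) = inj₂ (_ , appˡ t , n , appˡ* N u)
commute i (appˡ s) (appʳ r) = inj₂ (_ , appˡ s , 0 , ⟶β-appʳ (r , refl) ∷ [])
commute i (appʳ ≢ƛ _ _) root = ⊥-elim (≢ƛ _ refl)
commute i (appʳ _ nf _) (appˡ r) = ⊥-elim (nf r)
commute i (appʳ {M} ≢ƛ nf s) (appʳ r) with commute (Λᴵ-appʳ i) s r
... | inj₁ eq              = inj₁ (cong (M ·_) eq)
... | inj₂ (_ , t , n , u) = inj₂ (_ , appʳ ≢ƛ nf t , n , appʳ* M u)
commute i (lam s) (lam r) with commute (Λᴵ-lam i) s r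
... | inj₁ eq              = inj₁ (cong ƛ_ eq)
... | inj₂ (_ , t , n , u) = inj₂ (_ , lam t , n , lam* u)

Λᴵ-⟶β : ∀ {M N} → Λᴵ M → M ⟶β N → Λᴵ N
Λᴵ-⟶β i (r , refl) = Λᴵ-fire i r

⟶ˡ⇒⟶β : ∀ {M N} → M ⟶ˡ N → M ⟶β N
⟶ˡ⇒⟶β root         = root , refl
⟶ˡ⇒⟶β (appˡ s)     = ⟶β-appˡ (⟶ˡ⇒⟶β s)
⟶ˡ⇒⟶β (appʳ _ _ s) = ⟶β-appʳ (⟶ˡ⇒⟶β s)
⟶ˡ⇒⟶β (lam s)      = ⟶β-lam (⟶ˡ⇒⟶β s)

-- Induction on a bound of k: if the first step is not the leftmost one, the
-- commuting diagram is closed by applying the claim to its opposite side.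
⟶ˡ-maximal′ : ∀ {K k M V} → k ℕ.≤ K → Λᴵ M → M ⟶ˡ[ k ] V → ¬ Redex V →
  ∀ {n N} → M ⟶β[ n ] N → ∃ λ j → n ℕ.+ j ℕ.≤ k × N ⟶ˡ[ j ] V
⟶ˡ-maximal′ _ i ss nf [] = _ , ℕ.≤-refl , ss
⟶ˡ-maximal′ _ i [] nf ((r , _) ∷ _) = ⊥-elim (nf r)
⟶ˡ-maximal′ (ℕ.s≤s k≤K) i (s ∷ ss) nf ((r , refl) ∷ ts) with commute i s r
... | inj₁ refl =
  let (j , n+j≤k , us) = ⟶ˡ-maximal′ k≤K (Λᴵ-fire i r) ss nf ts
  in j , ℕ.s≤s n+j≤k , us
... | inj₂ (_ , s′ , m , rs) =
  let (j , m+j<k , us)  = ⟶ˡ-maximal′ k≤K (Λᴵ-⟶β i (⟶ˡ⇒⟶β s)) ss nf rs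
      -- As `rs` has at least one step, `s′ ∷ us` is no longer than `ss`. This permits the second
      -- recursive call and gives the final bound.
      j<k               = ℕ.≤-trans (ℕ.s≤s (ℕ.m≤n+m j m)) m+j<k
      (l , n+l≤j+1 , vs) = ⟶ˡ-maximal′ (ℕ.≤-trans j<k k≤K) (Λᴵ-fire i r) (s′ ∷ us) nf ts
  in l , ℕ.s≤s (ℕ.≤-trans n+l≤j+1 j<k) , vs

⟶ˡ-maximal : ∀ {k n M N V} → Λᴵ M → M ⟶ˡ[ k ] V → ¬ Redex V → M ⟶β[ n ] N → n ℕ.≤ k
⟶ˡ-maximal {n = n} i ss nf ts =
  let (j , n+j≤k , _) = ⟶ˡ-maximal′ ℕ.≤-refl i ss nf ts
  in ℕ.≤-trans (ℕ.m≤m+n n j) n+j≤k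

-- The order of the real numbers

½*δ>0 : ∀ {δ} → 0ℚ ℚ.< δ → 0ℚ ℚ.< ½ ℚ.* δ
½*δ>0 = ℚ.*-monoʳ-<-pos ½

½*δ+½*δ : ∀ δ → ½ ℚ.* δ ℚ.+ ½ ℚ.* δ ≡ δ
½*δ+½*δ δ = trans (sym (ℚ.*-distribʳ-+ δ ½ ½)) (ℚ.*-identityˡ δ)

pointwise-≤ℝ : ∀ {x y} → (∀ n → seq x n ℚ.≤ seq y n) → x ≤ℝ y
pointwise-≤ℝ {x} x≤y δ δ>0 = 0 , λ n _ →
  subst (ℚ._≤ _) (ℚ.+-identityʳ (seq x n)) (ℚ.+-mono-≤ (x≤y n) (ℚ.<⇒≤ δ>0))

≤ℝ-refl : ∀ {x} → x ≤ℝ x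
≤ℝ-refl {x} = pointwise-≤ℝ {x} {x} λ _ → ℚ.≤-refl

≤ℝ-trans : ∀ {x y z} → x ≤ℝ y → y ≤ℝ z → x ≤ℝ z
≤ℝ-trans {x} {y} {z} x≤y y≤z δ δ>0 =
  let (N , x≤) = x≤y (½ ℚ.* δ) (½*δ>0 δ>0)
      (K , y≤) = y≤z (½ ℚ.* δ) (½*δ>0 δ>0)
  in N ℕ.⊔ K , λ n ≤n → begin
    seq x n                                    ≤⟨ x≤ n (ℕ.m⊔n≤o⇒m≤o N K ≤n) ⟩
    seq y n ℚ.+ ½ ℚ.* δ                        ≤⟨ ℚ.+-monoˡ-≤ (½ ℚ.* δ) (y≤ n (ℕ.m⊔n≤o⇒n≤o N K ≤n)) ⟩
    seq z n ℚ.+ ½ ℚ.* δ ℚ.+ ½ ℚ.* δ            ≡⟨ ℚ.+-assoc (seq z n) _ _ ⟩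
    seq z n ℚ.+ (½ ℚ.* δ ℚ.+ ½ ℚ.* δ)          ≡⟨ cong (seq z n ℚ.+_) (½*δ+½*δ δ) ⟩
    seq z n ℚ.+ δ                              ∎
  where open ℚ.≤-Reasoning

+ℝ-mono-≤ : ∀ {x y z w} → x ≤ℝ y → z ≤ℝ w → x +ℝ z ≤ℝ y +ℝ w
+ℝ-mono-≤ {x} {y} {z} {w} x≤y z≤w δ δ>0 =
  let (N , x≤) = x≤y (½ ℚ.* δ) (½*δ>0 δ>0)
      (K , z≤) = z≤w (½ ℚ.* δ) (½*δ>0 δ>0)
  in N ℕ.⊔ K , λ n ≤n → begin
    seq x n ℚ.+ seq z n
      ≤⟨ ℚ.+-mono-≤ (x≤ n (ℕ.m⊔n≤o⇒m≤o N K ≤n)) (z≤ n (ℕ.m⊔n≤o⇒n≤o N K ≤n)) ⟩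
    (seq y n ℚ.+ ½ ℚ.* δ) ℚ.+ (seq w n ℚ.+ ½ ℚ.* δ)
      ≡⟨ regroup (seq y n) (seq w n) (½ ℚ.* δ) ⟩
    (seq y n ℚ.+ seq w n) ℚ.+ (½ ℚ.* δ ℚ.+ ½ ℚ.* δ)
      ≡⟨ cong (seq y n ℚ.+ seq w n ℚ.+_) (½*δ+½*δ δ) ⟩
    (seq y n ℚ.+ seq w n) ℚ.+ δ
      ∎
  where
  open ℚ.≤-Reasoning
  open +-*-Solver
  regroup : ∀ a b h → (a ℚ.+ h) ℚ.+ (b ℚ.+ h) ≡ (a ℚ.+ b) ℚ.+ (h ℚ.+ h)
  regroup = solve 3 (λ a b h → (a :+ h) :+ (b :+ h) := (a :+ b) :+ (h :+ h)) refl

eventually-≤ : ∀ x → ∃ λ B → Eventually λ n → seq x n ℚ.≤ B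
eventually-≤ x =
  let (N , close) = cauchy x 1ℚ (ℚ.positive⁻¹ 1ℚ)
  in seq x N ℚ.+ 1ℚ , N , λ n N≤n → begin
    seq x n                              ≡⟨ regroup (seq x N) (seq x n) ⟨
    seq x N ℚ.+ (seq x n ℚ.- seq x N)    ≤⟨ ℚ.+-monoʳ-≤ (seq x N) (p≤∣p∣ _) ⟩
    seq x N ℚ.+ ∣ seq x n ℚ.- seq x N ∣  ≤⟨ ℚ.+-monoʳ-≤ (seq x N) (ℚ.<⇒≤ (close n N N≤n ℕ.≤-refl)) ⟩
    seq x N ℚ.+ 1ℚ                       ∎
  where
  open ℚ.≤-Reasoning
  open +-*-Solver
  regroup : ∀ a b → a ℚ.+ (b ℚ.- a) ≡ b
  regroup = solve 2 (λ a b → a :+ (b :- a) := b) refl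
  p≤∣p∣ : ∀ p → p ℚ.≤ ∣ p ∣
  p≤∣p∣ p with ℚ.≤-total 0ℚ p
  ... | inj₁ 0≤p = ℚ.≤-reflexive (sym (ℚ.0≤p⇒∣p∣≡p 0≤p))
  ... | inj₂ p≤0 = ℚ.≤-trans p≤0 (ℚ.0≤∣p∣ p)

-- Terms of a sequence representing a nonnegative real may be negative by up to `η`. If one factor
-- is nonnegative, the product is at least minus that factor times `η`, hence at least `- (C * η)`;
-- two nonpositive factors have a nonnegative product.
*-approx-nonneg : ∀ {C η a b} → 0ℚ ℚ.≤ C → 0ℚ ℚ.≤ η → a ℚ.≤ C → b ℚ.≤ C →
  0ℚ ℚ.≤ a ℚ.+ η → 0ℚ ℚ.≤ b ℚ.+ η → 0ℚ ℚ.≤ a ℚ.* b ℚ.+ C ℚ.* η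
*-approx-nonneg {C} {η} {a} {b} 0≤C 0≤η a≤C b≤C 0≤a+η 0≤b+η
  with ℚ.≤-total 0ℚ a | ℚ.≤-total 0ℚ b
... | inj₁ 0≤a | _ = half a b a≤C 0≤a 0≤b+η
  where
  half : ∀ p q → p ℚ.≤ C → 0ℚ ℚ.≤ p → 0ℚ ℚ.≤ q ℚ.+ η → 0ℚ ℚ.≤ p ℚ.* q ℚ.+ C ℚ.* η
  half p q p≤C 0≤p 0≤q+η = begin
    0ℚ                        ≤⟨ ℚ.nonNegative⁻¹ _ {{ℚ.nonNeg*nonNeg⇒nonNeg p {{ℚ.nonNegative 0≤p}} (q ℚ.+ η) {{ℚ.nonNegative 0≤q+η}}}} ⟩
    p ℚ.* (q ℚ.+ η)           ≡⟨ ℚ.*-distribˡ-+ p q η ⟩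
    p ℚ.* q ℚ.+ p ℚ.* η       ≤⟨ ℚ.+-monoʳ-≤ (p ℚ.* q) (ℚ.*-monoʳ-≤-nonNeg η {{ℚ.nonNegative 0≤η}} p≤C) ⟩
    p ℚ.* q ℚ.+ C ℚ.* η       ∎
    where open ℚ.≤-Reasoning
... | inj₂ _ | inj₁ 0≤b = begin
    0ℚ                        ≤⟨ ℚ.nonNegative⁻¹ _ {{ℚ.nonNeg*nonNeg⇒nonNeg (a ℚ.+ η) {{ℚ.nonNegative 0≤a+η}} b {{ℚ.nonNegative 0≤b}}}} ⟩
    (a ℚ.+ η) ℚ.* b           ≡⟨ ℚ.*-distribʳ-+ b a η ⟩
    a ℚ.* b ℚ.+ η ℚ.* b       ≡⟨ cong (a ℚ.* b ℚ.+_) (ℚ.*-comm η b) ⟩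
    a ℚ.* b ℚ.+ b ℚ.* η       ≤⟨ ℚ.+-monoʳ-≤ (a ℚ.* b) (ℚ.*-monoʳ-≤-nonNeg η {{ℚ.nonNegative 0≤η}} b≤C) ⟩
    a ℚ.* b ℚ.+ C ℚ.* η       ∎
    where open ℚ.≤-Reasoning
... | inj₂ a≤0 | inj₂ b≤0 = ℚ.+-mono-≤ {0ℚ} {a ℚ.* b} {0ℚ} {C ℚ.* η}
  (ℚ.nonNegative⁻¹ _ {{ℚ.nonPos*nonPos⇒nonPos a {{ℚ.nonPositive a≤0}} b {{ℚ.nonPositive b≤0}}}})
  (ℚ.nonNegative⁻¹ _ {{ℚ.nonNeg*nonNeg⇒nonNeg C {{ℚ.nonNegative 0≤C}} η {{ℚ.nonNegative 0≤η}}}})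

*ℝ-nonneg : ∀ {x y} → 0ℝ ≤ℝ x → 0ℝ ≤ℝ y → 0ℝ ≤ℝ x *ℝ y
*ℝ-nonneg {x} {y} 0≤x 0≤y δ δ>0 =
  let (A , K , x≤A)  = eventually-≤ x
      (B , K′ , y≤B) = eventually-≤ y
      -- The maximum with 1 makes `C` positive, so that `η` can be taken as `δ` divided by `C`.
      C              = (A ℚ.⊔ B) ℚ.⊔ 1ℚ
      C>0            = ℚ.<-≤-trans (ℚ.positive⁻¹ 1ℚ) (ℚ.p≤q⊔p (A ℚ.⊔ B) 1ℚ)
      (η , η>0 , Cη≡δ) = quotient C>0
      (N , x≥)       = 0≤x η η>0
      (N′ , y≥)      = 0≤y η η>0
  in (K ℕ.⊔ K′) ℕ.⊔ (N ℕ.⊔ N′) , λ n ≤n →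
    let KK′≤n = ℕ.m⊔n≤o⇒m≤o (K ℕ.⊔ K′) (N ℕ.⊔ N′) ≤n
        NN′≤n = ℕ.m⊔n≤o⇒n≤o (K ℕ.⊔ K′) (N ℕ.⊔ N′) ≤n
    in subst (λ e → 0ℚ ℚ.≤ seq x n ℚ.* seq y n ℚ.+ e) Cη≡δ
      (*-approx-nonneg (ℚ.<⇒≤ C>0) (ℚ.<⇒≤ η>0)
        (ℚ.≤-trans (x≤A n (ℕ.m⊔n≤o⇒m≤o K K′ KK′≤n))
          (ℚ.≤-trans (ℚ.p≤p⊔q A B) (ℚ.p≤p⊔q (A ℚ.⊔ B) 1ℚ)))
        (ℚ.≤-trans (y≤B n (ℕ.m⊔n≤o⇒n≤o K K′ KK′≤n))
          (ℚ.≤-trans (ℚ.p≤q⊔p A B) (ℚ.p≤p⊔q (A ℚ.⊔ B) 1ℚ)))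
        (x≥ n (ℕ.m⊔n≤o⇒m≤o N N′ NN′≤n))
        (y≥ n (ℕ.m⊔n≤o⇒n≤o N N′ NN′≤n)))
  where
  quotient : ∀ {C} → 0ℚ ℚ.< C → ∃ λ η → 0ℚ ℚ.< η × C ℚ.* η ≡ δ
  quotient {C} C>0 =
      ℚ.1/ C ℚ.* δ
    , ℚ.positive⁻¹ _ {{ℚ.pos*pos⇒pos (ℚ.1/ C) {{ℚ.1/pos⇒pos C}} δ {{ℚ.positive δ>0}}}}
    , trans (sym (ℚ.*-assoc C (ℚ.1/ C) δ))
        (trans (cong (ℚ._* δ) (ℚ.*-inverseʳ C)) (ℚ.*-identityˡ δ))
    where
    instance
      C-pos : ℚ.Positive C
      C-pos = ℚ.positive C>0
      C-nonZero : ℚ.NonZero C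
      C-nonZero = ℚ.pos⇒nonZero C

1-nonneg : ∀ {x} → x ≤ℝ 1ℝ → 0ℝ ≤ℝ 1ℝ +ℝ -ℝ x
1-nonneg {x} x≤1 δ δ>0 =
  let (N , x≤) = x≤1 δ δ>0
  in N , λ n N≤n → begin
    0ℚ                                 ≡⟨ ℚ.+-inverseʳ (seq x n) ⟨
    seq x n ℚ.- seq x n                ≤⟨ ℚ.+-monoˡ-≤ (ℚ.- seq x n) (x≤ n N≤n) ⟩
    (1ℚ ℚ.+ δ) ℚ.- seq x n             ≡⟨ regroup δ (seq x n) ⟩
    (1ℚ ℚ.+ ℚ.- seq x n) ℚ.+ δ         ∎
  where
  open ℚ.≤-Reasoning
  open +-*-Solver
  regroup : ∀ d a → (1ℚ ℚ.+ d) ℚ.- a ≡ (1ℚ ℚ.+ ℚ.- a) ℚ.+ d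
  regroup = solve 2 (λ d a → (con 1ℚ :+ d) :- a := (con 1ℚ :+ :- a) :+ d) refl

-- Half of the gap `δ` absorbs the error allowed by `y ≤ℝ z`; the other half remains as the new gap.
<ℝ-≤ℝ-trans : ∀ {x y z} → x <ℝ y → y ≤ℝ z → x <ℝ z
<ℝ-≤ℝ-trans {x} {y} {z} (δ , δ>0 , N , x<y) y≤z =
  let (K , y≤) = y≤z (½ ℚ.* δ) (½*δ>0 δ>0)
  in ½ ℚ.* δ , ½*δ>0 δ>0 , N ℕ.⊔ K , λ n ≤n → +-cancelʳ-≤ (½ ℚ.* δ) (begin
    seq x n ℚ.+ ½ ℚ.* δ ℚ.+ ½ ℚ.* δ    ≡⟨ ℚ.+-assoc (seq x n) _ _ ⟩
    seq x n ℚ.+ (½ ℚ.* δ ℚ.+ ½ ℚ.* δ)  ≡⟨ cong (seq x n ℚ.+_) (½*δ+½*δ δ) ⟩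
    seq x n ℚ.+ δ                      ≤⟨ x<y n (ℕ.m⊔n≤o⇒m≤o N K ≤n) ⟩
    seq y n                            ≤⟨ y≤ n (ℕ.m⊔n≤o⇒n≤o N K ≤n) ⟩
    seq z n ℚ.+ ½ ℚ.* δ                ∎)
  where
  open ℚ.≤-Reasoning
  cancel : ∀ p r → (p ℚ.+ r) ℚ.+ ℚ.- r ≡ p
  cancel p r = trans (ℚ.+-assoc p r (ℚ.- r))
    (trans (cong (p ℚ.+_) (ℚ.+-inverseʳ r)) (ℚ.+-identityʳ p))
  +-cancelʳ-≤ : ∀ r {p q} → p ℚ.+ r ℚ.≤ q ℚ.+ r → p ℚ.≤ q
  +-cancelʳ-≤ r {p} {q} p+r≤q+r = begin
    p                        ≡⟨ cancel p r ⟨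
    (p ℚ.+ r) ℚ.+ ℚ.- r      ≤⟨ ℚ.+-monoˡ-≤ (ℚ.- r) p+r≤q+r ⟩
    (q ℚ.+ r) ℚ.+ ℚ.- r      ≡⟨ cancel q r ⟩
    q                        ∎

∑-mono-≤ : ∀ {A : Set} (xs : List A) {f g : A → ℝ} →
  (∀ x → f x ≤ℝ g x) → ∑ xs f ≤ℝ ∑ xs g
∑-mono-≤ []       f≤g = ≤ℝ-refl {0ℝ}
∑-mono-≤ (x ∷ xs) {f} {g} f≤g =
  +ℝ-mono-≤ {f x} {g x} {∑ xs f} {∑ xs g} (f≤g x) (∑-mono-≤ xs f≤g)

∑-nonneg : ∀ {A : Set} (xs : List A) {f : A → ℝ} →
  (∀ x → 0ℝ ≤ℝ f x) → 0ℝ ≤ℝ ∑ xs f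
∑-nonneg []       0≤f = ≤ℝ-refl {0ℝ}
∑-nonneg (x ∷ xs) {f} 0≤f =
  +ℝ-mono-≤ {0ℝ} {f x} {0ℝ} {∑ xs f} (0≤f x) (∑-nonneg xs 0≤f)

-- Finite sums of rationals

∑ℚ : {A : Set} → List A → (A → ℚ) → ℚ
∑ℚ xs f = foldr ℚ._+_ 0ℚ (map f xs)

-- Real operations act index by index, so identities between sums can be proved as exact equations
-- of rationals at each index.
seq-∑ : ∀ {A : Set} (xs : List A) (f : A → ℝ) n →
  seq (∑ xs f) n ≡ ∑ℚ xs λ x → seq (f x) n
seq-∑ []       f n = refl
seq-∑ (x ∷ xs) f n = cong (seq (f x) n ℚ.+_) (seq-∑ xs f n)

∑ℚ-cong : ∀ {A : Set} (xs : List A) {f g : A → ℚ} →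
  (∀ x → x ∈ xs → f x ≡ g x) → ∑ℚ xs f ≡ ∑ℚ xs g
∑ℚ-cong []       f≡g = refl
∑ℚ-cong (x ∷ xs) f≡g = cong₂ ℚ._+_ (f≡g x (here refl)) (∑ℚ-cong xs λ y → f≡g y ∘ there)

∑ℚ-zero : ∀ {A : Set} (xs : List A) → ∑ℚ xs (λ _ → 0ℚ) ≡ 0ℚ
∑ℚ-zero []       = refl
∑ℚ-zero (x ∷ xs) = trans (ℚ.+-identityˡ _) (∑ℚ-zero xs)

-- The disjunction is a constructive form of "nonzero only if `P`"; it lets positive mass be traced
-- back to a reduction.
∑ℚ-zero-or : ∀ {A P : Set} (xs : List A) {f : A → ℚ} →
  (∀ x → f x ≡ 0ℚ ⊎ P) → ∑ℚ xs f ≡ 0ℚ ⊎ P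
∑ℚ-zero-or []       f≡0 = inj₁ refl
∑ℚ-zero-or (x ∷ xs) f≡0 with f≡0 x | ∑ℚ-zero-or xs f≡0
... | inj₁ p | inj₁ q = inj₁ (cong₂ ℚ._+_ p q)
... | inj₂ p | _      = inj₂ p
... | _      | inj₂ p = inj₂ p

*-zero-or : ∀ {P Q : Set} {a b} → a ≡ 0ℚ ⊎ P → b ≡ 0ℚ ⊎ Q → a ℚ.* b ≡ 0ℚ ⊎ (P × Q)
*-zero-or {b = b} (inj₁ refl) _           = inj₁ (ℚ.*-zeroˡ b)
*-zero-or {a = a} (inj₂ _)    (inj₁ refl) = inj₁ (ℚ.*-zeroʳ a)
*-zero-or         (inj₂ p)    (inj₂ q)    = inj₂ (p , q)

∑ℚ-+ : ∀ {A : Set} (xs : List A) (f g : A → ℚ) →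
  ∑ℚ xs (λ x → f x ℚ.+ g x) ≡ ∑ℚ xs f ℚ.+ ∑ℚ xs g
∑ℚ-+ []       f g = refl
∑ℚ-+ (x ∷ xs) f g = trans (cong (f x ℚ.+ g x ℚ.+_) (∑ℚ-+ xs f g))
  (regroup (f x) (g x) (∑ℚ xs f) (∑ℚ xs g))
  where
  open +-*-Solver
  regroup : ∀ a b c d → (a ℚ.+ b) ℚ.+ (c ℚ.+ d) ≡ (a ℚ.+ c) ℚ.+ (b ℚ.+ d)
  regroup = solve 4 (λ a b c d → (a :+ b) :+ (c :+ d) := (a :+ c) :+ (b :+ d)) refl

∑ℚ-* : ∀ {A : Set} (xs : List A) a (f : A → ℚ) →
  ∑ℚ xs (λ x → a ℚ.* f x) ≡ a ℚ.* ∑ℚ xs f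
∑ℚ-* []       a f = sym (ℚ.*-zeroʳ a)
∑ℚ-* (x ∷ xs) a f = trans (cong (a ℚ.* f x ℚ.+_) (∑ℚ-* xs a f))
  (sym (ℚ.*-distribˡ-+ a (f x) (∑ℚ xs f)))

∑ℚ-swap : ∀ {A B : Set} (xs : List A) (ys : List B) (f : A → B → ℚ) →
  ∑ℚ xs (λ x → ∑ℚ ys (f x)) ≡ ∑ℚ ys (λ y → ∑ℚ xs λ x → f x y)
∑ℚ-swap []       ys f = sym (∑ℚ-zero ys)
∑ℚ-swap (x ∷ xs) ys f = trans (cong (∑ℚ ys (f x) ℚ.+_) (∑ℚ-swap xs ys f))
  (sym (∑ℚ-+ ys (f x) λ y → ∑ℚ xs λ x → f x y))

-- Distributions

dirac-≡ : ∀ M n → seq (mass (dirac M) M) n ≡ 1ℚ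
dirac-≡ M n with M ≟ M
... | yes _  = refl
... | no M≢M = ⊥-elim (M≢M refl)

dirac-≢ : ∀ {M N} n → M ≢ N → seq (mass (dirac M) N) n ≡ 0ℚ
dirac-≢ {M} {N} n M≢N with M ≟ N
... | yes M≡N = ⊥-elim (M≢N M≡N)
... | no _    = refl

dirac-zero-or-≡ : ∀ M N n → seq (mass (dirac M) N) n ≡ 0ℚ ⊎ M ≡ N
dirac-zero-or-≡ M N n with M ≟ N
... | yes M≡N = inj₂ M≡N
... | no _    = inj₁ refl

dirac-nonneg : ∀ M N → 0ℝ ≤ℝ mass (dirac M) N
dirac-nonneg M N with M ≟ N
... | yes _ = pointwise-≤ℝ {0ℝ} {1ℝ} λ _ → ℚ.nonNegative⁻¹ 1ℚ
... | no _  = ≤ℝ-refl {0ℝ}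

∑ℚ-dirac : ∀ {M xs} n → Unique xs → M ∈ xs →
  ∑ℚ xs (λ N → seq (mass (dirac M) N) n) ≡ 1ℚ
∑ℚ-dirac {xs = M ∷ xs} n (M∉ ∷ _) (here refl) = cong₂ ℚ._+_ (dirac-≡ M n)
  (trans (∑ℚ-cong xs λ N N∈ → dirac-≢ n (All.lookup M∉ N∈)) (∑ℚ-zero xs))
∑ℚ-dirac {xs = N ∷ xs} n (N∉ ∷ uniq) (there M∈) = cong₂ ℚ._+_
  (dirac-≢ n λ M≡N → All.lookup N∉ M∈ (sym M≡N)) (∑ℚ-dirac n uniq M∈)

-- The total mass of `ℙ[ ε ] M`, which is the same for all `ε`.
weight : Λ → ℚ
weight M with reducible? M
... | yes _ = 1ℚ
... | no _  = 0ℚ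

-- Both coefficients use the same approximation `e` of `ε`, so `e` and `1 - e` add up to exactly 1
-- at every index.
∑ℚ-ℙ : ∀ ε M {xs} n → Unique xs → (∀ {N} → N ∈ support (ℙ[ ε ] M) → N ∈ xs) →
  ∑ℚ xs (λ N → seq (mass (ℙ[ ε ] M) N) n) ≡ weight M
∑ℚ-ℙ ε M {xs} n uniq ⊆xs with reducible? M
... | no _    = ∑ℚ-zero xs
... | yes red = begin
  ∑ℚ xs (λ N → e ℚ.* L N ℚ.+ (1ℚ ℚ.+ ℚ.- e) ℚ.* R N)
    ≡⟨ ∑ℚ-+ xs (λ N → e ℚ.* L N) (λ N → (1ℚ ℚ.+ ℚ.- e) ℚ.* R N) ⟩
  ∑ℚ xs (λ N → e ℚ.* L N) ℚ.+ ∑ℚ xs (λ N → (1ℚ ℚ.+ ℚ.- e) ℚ.* R N)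
    ≡⟨ cong₂ ℚ._+_ (∑ℚ-* xs e L) (∑ℚ-* xs (1ℚ ℚ.+ ℚ.- e) R) ⟩
  e ℚ.* ∑ℚ xs L ℚ.+ (1ℚ ℚ.+ ℚ.- e) ℚ.* ∑ℚ xs R
    ≡⟨ cong₂ (λ l r → e ℚ.* l ℚ.+ (1ℚ ℚ.+ ℚ.- e) ℚ.* r)
         (∑ℚ-dirac n uniq (⊆xs (∈-deduplicate⁺ _≟_ {LO M red ∷ RI M red ∷ []} (here refl))))
         (∑ℚ-dirac n uniq (⊆xs (∈-deduplicate⁺ _≟_ {LO M red ∷ RI M red ∷ []} (there (here refl))))) ⟩
  e ℚ.* 1ℚ ℚ.+ (1ℚ ℚ.+ ℚ.- e) ℚ.* 1ℚ
    ≡⟨ regroup e ⟩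
  1ℚ ∎
  where
  open ≡-Reasoning
  e = seq (value ε) n
  L R : Λ → ℚ
  L N = seq (mass (dirac (LO M red)) N) n
  R N = seq (mass (dirac (RI M red)) N) n
  regroup : ∀ a → a ℚ.* 1ℚ ℚ.+ (1ℚ ℚ.+ ℚ.- a) ℚ.* 1ℚ ≡ 1ℚ
  regroup = solve 1 (λ a → a :* con 1ℚ :+ (con 1ℚ :+ :- a) :* con 1ℚ := con 1ℚ) refl
    where open +-*-Solver

-- Exchanging the two sums leaves, for each `L`, the total mass of `ℙ[ ε ] L`: a step keeps
-- precisely the mass on reducible terms.
total-step : ∀ ε ρ n →
  seq (total (step ε ρ)) n ≡ ∑ℚ (support ρ) λ L → seq (mass ρ L) n ℚ.* weight L
total-step ε ρ n = begin
  seq (total (step ε ρ)) n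
    ≡⟨ seq-∑ Ns (mass (step ε ρ)) n ⟩
  ∑ℚ Ns (λ N → seq (mass (step ε ρ) N) n)
    ≡⟨ ∑ℚ-cong Ns (λ N _ → seq-∑ (support ρ) (λ L → mass ρ L *ℝ mass (ℙ[ ε ] L) N) n) ⟩
  ∑ℚ Ns (λ N → ∑ℚ (support ρ) λ L → seq (mass ρ L) n ℚ.* seq (mass (ℙ[ ε ] L) N) n)
    ≡⟨ ∑ℚ-swap Ns (support ρ) (λ N L → seq (mass ρ L) n ℚ.* seq (mass (ℙ[ ε ] L) N) n) ⟩
  ∑ℚ (support ρ) (λ L → ∑ℚ Ns λ N → seq (mass ρ L) n ℚ.* seq (mass (ℙ[ ε ] L) N) n)
    ≡⟨ ∑ℚ-cong (support ρ) (λ L L∈ → trans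
         (∑ℚ-* Ns (seq (mass ρ L) n) (λ N → seq (mass (ℙ[ ε ] L) N) n))
         (cong (seq (mass ρ L) n ℚ.*_) (∑ℚ-ℙ ε L n (unique (step ε ρ)) λ N∈ →
           ∈-deduplicate⁺ _≟_ (∈-concatMap⁺ (support ∘ ℙ[ ε ])
             (Any.map (λ { refl → N∈ }) L∈))))) ⟩
  ∑ℚ (support ρ) (λ L → seq (mass ρ L) n ℚ.* weight L)
    ∎
  where
  open ≡-Reasoning
  Ns : List Λ
  Ns = support (step ε ρ)

ℙ-nonneg : ∀ ε M N → 0ℝ ≤ℝ mass (ℙ[ ε ] M) N
ℙ-nonneg ε M N with reducible? M
... | no _    = ≤ℝ-refl {0ℝ}
... | yes red = +ℝ-mono-≤ {0ℝ} {value ε *ℝ l} {0ℝ} {(1ℝ +ℝ -ℝ value ε) *ℝ r}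
  (*ℝ-nonneg {value ε} {l} ([0,1].lower ε) (dirac-nonneg (LO M red) N))
  (*ℝ-nonneg {1ℝ +ℝ -ℝ value ε} {r} (1-nonneg {value ε} ([0,1].upper ε))
    (dirac-nonneg (RI M red) N))
  where
  l = mass (dirac (LO M red)) N
  r = mass (dirac (RI M red)) N

computation-nonneg : ∀ ε M i N → 0ℝ ≤ℝ mass (computation ε M i) N
computation-nonneg ε M zero    N = dirac-nonneg M N
computation-nonneg ε M (suc i) N = ∑-nonneg (support ρ) λ L →
  *ℝ-nonneg {mass ρ L} {mass (ℙ[ ε ] L) N} (computation-nonneg ε M i L) (ℙ-nonneg ε L N)
  where ρ = computation ε M i

total-step-≤ : ∀ ε ρ → (∀ L → 0ℝ ≤ℝ mass ρ L) → total (step ε ρ) ≤ℝ total ρ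
total-step-≤ ε ρ 0≤ρ =
  ≤ℝ-trans {total (step ε ρ)} {weighted} {total ρ}
    (pointwise-≤ℝ {total (step ε ρ)} {weighted} λ n → ℚ.≤-reflexive
      (trans (total-step ε ρ n) (sym (seq-∑ (support ρ) _ n))))
    (∑-mono-≤ (support ρ) *weight≤)
  where
  weighted : ℝ
  weighted = ∑ (support ρ) λ L → mass ρ L *ℝ constℝ (weight L)
  *weight≤ : ∀ L → mass ρ L *ℝ constℝ (weight L) ≤ℝ mass ρ L
  *weight≤ L with reducible? L
  ... | yes _ = pointwise-≤ℝ {mass ρ L *ℝ 1ℝ} {mass ρ L} λ n →
    ℚ.≤-reflexive (ℚ.*-identityʳ (seq (mass ρ L) n))
  ... | no _ = ≤ℝ-trans {mass ρ L *ℝ 0ℝ} {0ℝ} {mass ρ L}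
    (pointwise-≤ℝ {mass ρ L *ℝ 0ℝ} {0ℝ} λ n →
      ℚ.≤-reflexive (ℚ.*-zeroʳ (seq (mass ρ L) n)))
    (0≤ρ L)

total-dirac : ∀ M n → seq (total (dirac M)) n ≡ 1ℚ
total-dirac M n = cong (ℚ._+ 0ℚ) (dirac-≡ M n)

total-≤1 : ∀ ε M i → total (computation ε M i) ≤ℝ 1ℝ
total-≤1 ε M zero    = pointwise-≤ℝ {total (dirac M)} {1ℝ} λ n → ℚ.≤-reflexive (total-dirac M n)
total-≤1 ε M (suc i) = ≤ℝ-trans {total (step ε ρ)} {total ρ} {1ℝ}
  (total-step-≤ ε ρ (computation-nonneg ε M i)) (total-≤1 ε M i)
  where ρ = computation ε M i

-- Supports, masses and reductions

∈-support-ℙ : ∀ ε M {N} → N ∈ support (ℙ[ ε ] M) → M ⟶β N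
∈-support-ℙ ε M N∈ with reducible? M
... | yes red@(_ , r , _) with ∈-deduplicate⁻ _≟_ (LO M red ∷ RI M red ∷ []) N∈
...   | here refl         = argmin position r (redexes M) , refl
...   | there (here refl) = argmax position r (redexes M) , refl

∈-support-computation : ∀ ε M i {N} → N ∈ support (computation ε M i) → M ⟶β[ i ] N
∈-support-computation ε M zero    (here refl) = []
∈-support-computation ε M (suc i) N∈ =
  let (L , L∈ , N∈ℙ) = find (∈-concatMap⁻ (support ∘ ℙ[ ε ]) (∈-deduplicate⁻ _≟_ _ N∈))
  in snoc (∈-support-computation ε M i L∈) (∈-support-ℙ ε L N∈ℙ)

-- Stated for masses because `RI M` stays in the support at `ε = 1`, with coefficient 0.
ℙ-𝟙 : ∀ M N n → seq (mass (ℙ[ 𝟙 ] M) N) n ≡ 0ℚ ⊎ M ⟶ˡ N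
ℙ-𝟙 M N n with reducible? M
... | no _    = inj₁ refl
... | yes red with dirac-zero-or-≡ (LO M red) N n
...   | inj₁ p = inj₁ (cong₂ ℚ._+_ (trans (ℚ.*-identityˡ _) p) (ℚ.*-zeroˡ (seq (mass (dirac (RI M red)) N) n)))
...   | inj₂ p = inj₂ (subst (M ⟶ˡ_) p (⟶ˡ-LO M red))

step-zero-or : ∀ ε ρ N n {P Q : Λ → Set} →
  (∀ L → seq (mass ρ L) n ≡ 0ℚ ⊎ P L) → (∀ L → seq (mass (ℙ[ ε ] L) N) n ≡ 0ℚ ⊎ Q L) →
  seq (mass (step ε ρ) N) n ≡ 0ℚ ⊎ ∃ λ L → P L × Q L
step-zero-or ε ρ N n ρ-or ℙ-or =
  [ inj₁ ∘ trans (seq-∑ (support ρ) (λ L → mass ρ L *ℝ mass (ℙ[ ε ] L) N) n) , inj₂ ]′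
    (∑ℚ-zero-or (support ρ) λ L → map₂ (L ,_) (*-zero-or (ρ-or L) (ℙ-or L)))

computation-𝟙 : ∀ M i N n → seq (mass (computation 𝟙 M i) N) n ≡ 0ℚ ⊎ M ⟶ˡ[ i ] N
computation-𝟙 M zero N n = map₂ (λ { refl → [] }) (dirac-zero-or-≡ M N n)
computation-𝟙 M (suc i) N n = map₂ (λ (_ , ss , s) → snoc ss s)
  (step-zero-or 𝟙 (computation 𝟙 M i) N n (λ L → computation-𝟙 M i L n) (λ L → ℙ-𝟙 L N n))

weight-reducible : ∀ {M} → Redex M → weight M ≡ 1ℚ
weight-reducible {M} r with reducible? M
... | yes _  = refl
... | no irr = ⊥-elim (irr (fire r , r , refl))

-- By determinism, at each earlier stage all the mass lies on the one term that the leftmost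
-- reduction reaches. That term has a further step, hence weight 1, and no mass is lost.
total-𝟙 : ∀ {M N} i n → M ⟶ˡ[ i ] N → seq (total (computation 𝟙 M i)) n ≡ 1ℚ
total-𝟙 {M} zero    n _  = total-dirac M n
total-𝟙 {M} (suc i) n ss =
  let (K , ts , t) = unsnoc ss
      *weight≡ : ∀ L → L ∈ support ρ → seq (mass ρ L) n ℚ.* weight L ≡ seq (mass ρ L) n
      *weight≡ L _ = [ (λ p → trans (cong (ℚ._* weight L) p) (trans (ℚ.*-zeroˡ (weight L)) (sym p)))
                     , (λ us → trans (cong (seq (mass ρ L) n ℚ.*_) (weight-reducible
                         (subst Redex (⟶ˡ[]-deterministic ts us) (⟶ˡ⇒redex t))))
                         (ℚ.*-identityʳ _))
                     ]′ (computation-𝟙 M i L n)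
  in begin
    seq (total (step 𝟙 ρ)) n                               ≡⟨ total-step 𝟙 ρ n ⟩
    ∑ℚ (support ρ) (λ L → seq (mass ρ L) n ℚ.* weight L)   ≡⟨ ∑ℚ-cong (support ρ) *weight≡ ⟩
    ∑ℚ (support ρ) (λ L → seq (mass ρ L) n)                ≡⟨ seq-∑ (support ρ) (mass ρ) n ⟨
    seq (total ρ) n                                        ≡⟨ total-𝟙 i n ts ⟩
    1ℚ                                                     ∎
  where
  open ≡-Reasoning
  ρ = computation 𝟙 M i

-- Comparison of the strategies

-- Decidability of reducibility makes this alternative constructive at each fixed `i`, without
-- deciding whether `M` has a normal form.
⟶ˡ-continues-or-stops : ∀ M i → (∃ λ N → M ⟶ˡ[ i ] N) ⊎
  ∃₂ λ k V → k ℕ.< i × M ⟶ˡ[ k ] V × ¬ Redex V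
⟶ˡ-continues-or-stops M zero = inj₁ (M , [])
⟶ˡ-continues-or-stops M (suc i) with ⟶ˡ-continues-or-stops M i
... | inj₂ (k , V , k<i , rest) = inj₂ (k , V , ℕ.m<n⇒m<1+n k<i , rest)
... | inj₁ (N , ss) with reducible? N
...   | yes red = inj₁ (_ , snoc ss (⟶ˡ-LO N red))
...   | no irr  = inj₂ (i , N , ℕ.≤-refl , ss , λ r → irr (fire r , r , refl))

∑-empty-≤ : ∀ {A : Set} (xs : List A) {f x} → (∀ a → a ∉ xs) → 0ℝ ≤ℝ x → ∑ xs f ≤ℝ x
∑-empty-≤ []      _  0≤x = 0≤x
∑-empty-≤ (a ∷ _) a∉ _   = ⊥-elim (a∉ a (here refl))

total-≤-total-𝟙 : ∀ {M} → Λᴵ M → ∀ ε i →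
  total (computation ε M i) ≤ℝ total (computation 𝟙 M i)
total-≤-total-𝟙 {M} M∈Λᴵ ε i = [ continues , stops ]′ (⟶ˡ-continues-or-stops M i)
  where
  ρ τ : FinSupp
  ρ = computation ε M i
  τ = computation 𝟙 M i
  continues : (∃ λ N → M ⟶ˡ[ i ] N) → total ρ ≤ℝ total τ
  continues (_ , ss) = ≤ℝ-trans {total ρ} {1ℝ} {total τ} (total-≤1 ε M i)
    (pointwise-≤ℝ {1ℝ} {total τ} λ n → ℚ.≤-reflexive (sym (total-𝟙 i n ss)))
  stops : (∃₂ λ k V → k ℕ.< i × M ⟶ˡ[ k ] V × ¬ Redex V) → total ρ ≤ℝ total τ
  stops (_ , _ , k<i , ss , nf) = ∑-empty-≤ (support ρ) {mass ρ} {total τ}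
    -- A term of the support would end a reduction of `i` steps, against the maximality of the `k`
    -- leftmost steps.
    (λ N N∈ → ℕ.<⇒≱ k<i (⟶ˡ-maximal M∈Λᴵ ss nf (∈-support-computation ε M i N∈)))
    (∑-nonneg (support τ) (computation-nonneg 𝟙 M i))

corollary2 : ∀ (M : Λ) → Λᴵ M → ∀ (ε : [0,1]) → ExpLen M ε ≤∞ ExpLen M 𝟙
-- The same partial sum witnesses both lower bounds, so finite and infinite values are treated
-- alike.
corollary2 M M∈Λᴵ ε q (n , q<) = n ,
  <ℝ-≤ℝ-trans {constℝ q} {∑ (upTo n) λ i → total (computation ε M (suc i))}
    {∑ (upTo n) λ i → total (computation 𝟙 M (suc i))}
    q< (∑-mono-≤ (upTo n) λ i → total-≤-total-𝟙 M∈Λᴵ ε (suc i))
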